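{- The iterated integral of $f_0(x)=\ln(x+a)$ is given by $$f_n(x) = -\frac{1}{n!}\sum_{k=1}^{n}\frac{x^k (x+a)^{n-k}}{k} - \frac{(x+a)^n-x^n}{n!}\,\ln a + \frac{(x+a)^n}{n!}\,\ln(x+a).$$
   Context: The iterated integrals of a function $f_0(x)$ are the functions $f_n$ defined by $f_n(x)=\int_0^x f_{n-1}(t)\,dt$ for $n\ge 1$; in particular $f_n(0)=0$ for $n\ge1$. -}

module Defs where

open import Algebra.Apartness.Bundles using (HeytingCommutativeRing; HeytingField)
open import Algebra.Bundles using (CommutativeRing)
open import Data.Fin.Base using (Fin; zero; suc; inject₁; fromℕ; toℕ)
open import Data.Nat.Base as ℕ using (ℕ; zero; suc; NonZero)
open import Data.Product.Base using (Σ-syntax; ∃-syntax; _×_; _,_; proj₁)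
open import Data.Sum.Base using (_⊎_; inj₁; inj₂)
open import Level using (Level; _⊔_) renaming (suc to lsuc)
open import Relation.Binary.Core using (Rel)
open import Relation.Binary.Structures using (IsStrictPartialOrder)
open import Relation.Nullary.Negation using (¬_)
import Algebra.Definitions.RawMonoid as RawMonoidDefs
import Algebra.Properties.Semiring.Exp as SemiringExp

-- The real numbers, given by their characterization (unique up to isomorphism)
-- as the Cauchy-complete Archimedean ordered field.  The axioms are the
-- constructive ones, so Cauchy sequences come with a modulus; with excluded
-- middle they are equivalent to the usual classical axioms.
record RealField c ℓ₁ ℓ₂ : Set (lsuc (c ⊔ ℓ₁ ⊔ ℓ₂)) where
  infix 4 _<_ _≤_
  field
    heytingField : HeytingField c ℓ₁ ℓ₂

  open HeytingField heytingField public

  commutativeRing : CommutativeRing c ℓ₁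
  commutativeRing = HeytingCommutativeRing.commutativeRing heytingCommutativeRing

  open CommutativeRing commutativeRing public using (+-rawMonoid; semiring)
  open RawMonoidDefs +-rawMonoid public using (sum) renaming (_×_ to _·_)
  open SemiringExp semiring public using (_^_)

  field
    _<_                  : Rel Carrier ℓ₂
    isStrictPartialOrder : IsStrictPartialOrder _≈_ _<_
    #⇒<⊎>                : ∀ {x y} → x # y → x < y ⊎ y < x
    <⇒#                  : ∀ {x y} → x < y → x # y
    0<1                  : 0# < 1#
    +-monoˡ-<            : ∀ z {x y} → x < y → x + z < y + z
    *-pos                : ∀ {x y} → 0# < x → 0# < y → 0# < x * y

  _≤_ : Rel Carrier ℓ₂
  x ≤ y = ¬ (y < x)

  -- |x - y| < ε
  Close : Carrier → Carrier → Carrier → Set ℓ₂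
  Close ε x y = x - y < ε × y - x < ε

  IsCauchy : (ℕ → Carrier) → Set (c ⊔ ℓ₂)
  IsCauchy s = ∀ ε → 0# < ε →
    ∃[ N ] (∀ m n → N ℕ.≤ m → N ℕ.≤ n → Close ε (s m) (s n))

  IsLimit : (ℕ → Carrier) → Carrier → Set (c ⊔ ℓ₂)
  IsLimit s l = ∀ ε → 0# < ε → ∃[ N ] (∀ n → N ℕ.≤ n → Close ε (s n) l)

  field
    archimedean : ∀ x → ∃[ n ] x < n · 1#
    complete    : ∀ s → IsCauchy s → ∃[ l ] IsLimit s l

module Analysis {c ℓ₁ ℓ₂} (ℝ : RealField c ℓ₁ ℓ₂) where
  open RealField ℝ hiding (zero)
  open IsStrictPartialOrder isStrictPartialOrder using (<-respʳ-≈; <-respˡ-≈)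
    renaming (trans to <-trans)

  #0 : ∀ {x} → 0# < x → x # 0#
  #0 0<x = #-sym (<⇒# 0<x)

  -- #⇒invertible inverts x - 0#, which is ≈-equal to x.
  inverse : ∀ x → x # 0# → Carrier
  inverse x x#0 = proj₁ (#⇒invertible x#0)

  0<n : ∀ n → .{{NonZero n}} → 0# < n · 1#
  0<n (suc zero)    = <-respʳ-≈ (sym (+-identityʳ 1#)) 0<1
  0<n (suc (suc n)) =
    <-trans (0<n (suc n))
      (<-respˡ-≈ (+-identityˡ _) (+-monoˡ-< (suc n · 1#) 0<1))

  infix 9 1/_
  1/_ : ∀ n → .{{NonZero n}} → Carrier
  1/ n = inverse (n · 1#) (#0 (0<n n))

  -- The sum of f k over 1 ≤ k ≤ n.
  ∑₁ : ∀ n → (∀ k → .{{NonZero k}} → Carrier) → Carrier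
  ∑₁ n f = sum {n} (λ i → f (suc (toℕ i)))

  PartialFunction : ∀ {p} → (Carrier → Set p) → Set (c ⊔ p)
  PartialFunction D = ∀ x → D x → Carrier

  Between : Carrier → Carrier → Carrier → Set ℓ₂
  Between u v x = (u ≤ x × x ≤ v) ⊎ (v ≤ x × x ≤ u)

  -- A partition runs from u to v in either direction.  The increments in a
  -- Riemann sum are signed, so that ∫ᵤᵛ = - ∫ᵥᵘ.
  record TaggedPartition (u v : Carrier) : Set (c ⊔ ℓ₁ ⊔ ℓ₂) where
    field
      size    : ℕ
      point   : Fin (suc size) → Carrier
      tag     : Fin size → Carrier
      start   : point zero ≈ u
      end     : point (fromℕ size) ≈ v
      ordered : (∀ i → point (inject₁ i) ≤ tag i × tag i ≤ point (suc i))
              ⊎ (∀ i → point (suc i) ≤ tag i × tag i ≤ point (inject₁ i))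

    FinerThan : Carrier → Set ℓ₂
    FinerThan δ = ∀ i → Close δ (point (suc i)) (point (inject₁ i))

    riemannSum : ∀ {p} {D : Carrier → Set p} →
                 PartialFunction D → (∀ i → D (tag i)) → Carrier
    riemannSum g tag∈D =
      sum (λ i → g (tag i) (tag∈D i) * (point (suc i) - point (inject₁ i)))

  -- g is Riemann integrable on the segment with endpoints u and v, and
  -- ∫ᵤᵛ g(t) dt = I.
  IsIntegral : ∀ {p} {D : Carrier → Set p} →
               PartialFunction D → Carrier → Carrier → Carrier →
               Set (c ⊔ ℓ₁ ⊔ ℓ₂ ⊔ p)
  IsIntegral {D = D} g u v I =
    (∀ t → Between u v t → D t) ×
    (∀ ε → 0# < ε → Σ[ δ ∈ Carrier ] (0# < δ ×
      (∀ (P : TaggedPartition u v) → let open TaggedPartition P in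
        (tag∈D : ∀ i → D (tag i)) → FinerThan δ →
        Close ε (riemannSum g tag∈D) I)))

  Positive : Carrier → Set ℓ₂
  Positive x = 0# < x

  reciprocal : PartialFunction Positive
  reciprocal t 0<t = inverse t (#0 0<t)

  -- ln y = ∫₁ʸ dt/t for y > 0, which determines ln uniquely.
  IsLn : PartialFunction Positive → Set (c ⊔ ℓ₁ ⊔ ℓ₂)
  IsLn ln = ∀ y 0<y → IsIntegral reciprocal 1# y (ln y 0<y)

  record IsIteratedIntegrals {p} {D : Carrier → Set p} (f₀ : PartialFunction D)
         (f : ℕ → PartialFunction D) : Set (c ⊔ ℓ₁ ⊔ ℓ₂ ⊔ p) where
    field
      base : ∀ x x∈D → f 0 x x∈D ≈ f₀ x x∈D
      step : ∀ n x x∈D → IsIntegral (f n) 0# x (f (suc n) x x∈D)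

{-# OPTIONS --safe #-}
module Submission where

-- Riemann sums of f against an antiderivative G telescope: on a cell of length
-- h ≤ δ the error is at most 2 M h², where M bounds the quadratic error of the
-- derivative of G, so the total error is at most 2 M δ times the length of the
-- segment.  For ln the quadratic error comes from ln v - ln u ≤ (v - u) / u, which
-- holds for the Riemann sums of 1/t from u to v.  Writing s = x + a and Qₙ = n! fₙ,
-- the closed form satisfies Q₀ = ln s and
--   Qₙ₊₁ = s Qₙ - xⁿ⁺¹ / (n + 1) - a xⁿ ln a,
-- from which Qₙ₊₁′ = (n + 1) Qₙ and Qₙ₊₁(0) = 0 follow by induction.
-- Weak inequalities and ≈ are negative statements, so they may be proved by
-- comparing reals classically; only the moduli δ have to be constructed.

-- The two implications differ in nature. That the closed form consists of successive integrals is
-- the telescoping argument; that every sequence of iterated integrals equals it needs uniqueness of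
-- the integral, hence actual partitions of arbitrarily small mesh, and these come from the
-- Archimedean axiom. The quadratic error must be uniform on the segment from 0 to x; there 1/(t +
-- a) is controlled by its values at the two ends. The recursion for Qₙ avoids differentiating the
-- finite sum: each step is a product with s plus monomials. The product rule in turn forces bounds
-- and Lipschitz constants to be carried along with the quadratic error. `ln` is known only through
-- integrals starting at 1. Its increment from u to v can be read off from Riemann sums when u lies
-- between 1 and v; the other orders are reduced to this one or pass through 1. The resulting
-- inequality, used at u and again at v, places ln v - ln u - (v - u)/u between -(v - u)²/(u v) and
-- 0.

open import Defs
open import Data.Nat.Base using (ℕ; _!; _∸_)
open import Data.Nat.Properties using (_!≢0)
open import Function.Bundles using (_⇔_)

open import Algebra.Bundles using (CommutativeRing; RawRing)
open import Algebra.Solver.Ring.AlmostCommutativeRing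
  using (fromCommutativeRing; -raw-almostCommutative⟶; _-Raw-AlmostCommutative⟶_)
open import Data.Empty using (⊥)
open import Data.Fin.Base using (Fin; zero; suc; inject₁; fromℕ; toℕ)
open import Data.Fin.Properties using (toℕ-inject₁; toℕ-fromℕ; toℕ<n)
open import Data.Maybe.Base using (Maybe; just; nothing)
open import Data.Nat.Base as ℕ using (zero; suc; NonZero)
import Data.Nat.Properties as ℕ
open import Data.Product.Base using (Σ-syntax; ∃-syntax; _×_; _,_; proj₁; proj₂)
open import Data.Sum.Base using (_⊎_; inj₁; inj₂)
open import Function.Bundles using (mk⇔)
open import Level using (_⊔_)
open import Relation.Binary.PropositionalEquality as ≡ using (_≡_)
open import Relation.Binary.Structures using (IsStrictPartialOrder)
open import Relation.Nullary.Decidable.Core using (yes; no)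
open import Relation.Nullary.Negation using (¬_; contradiction)
import Algebra.Properties.Semiring.Sum as SemiringSum
import Algebra.Properties.Group as GroupProperties
import Algebra.Properties.Ring as RingProperties
import Algebra.Properties.Semiring.Mult as SemiringMult
import Algebra.Apartness.Properties.HeytingCommutativeRing as HeytingProperties
import Algebra.Solver.Ring as RingSolver
import Relation.Binary.Reasoning.Setoid as ≈-Reasoning

-- Ring identities with integer coefficients

-- The coefficient (m , n) stands for m - n, so that the solver can cancel
-- although equality in the ring is undecidable.
module IntegerRingSolver {c ℓ} (R : CommutativeRing c ℓ) where
  open CommutativeRing R
  open SemiringMult semiring using (×1-homo-*; ×-homo-+) renaming (_×_ to _·_)
  open RingProperties ring using (-‿distribˡ-*; -‿distribʳ-*; -‿involutive; -‿+-comm)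
  open GroupProperties +-group using (⁻¹-anti-homo-//)

  private
    ACR = fromCommutativeRing R
    -- A bootstrap solver that decides no equality of coefficients; cancellations such as `n - n`
    -- are therefore done by hand until the homomorphism is available.
    module Free = RingSolver _ ACR (-raw-almostCommutative⟶ ACR) (λ _ _ → nothing)
    open Free using (_:+_; _:*_; _:-_; :-_; _:=_)

    difference : ℕ × ℕ → Carrier
    difference (m , n) = m · 1# - n · 1#

    -- The representative with a zero component; without it the solver's normal
    -- forms would not be unique.
    reduce : ℕ × ℕ → ℕ × ℕ
    reduce (m , n) = m ∸ n , n ∸ m

    ℕ-differences : RawRing _ _
    ℕ-differences = record
      { Carrier = ℕ × ℕ
      ; _≈_     = λ p q → proj₁ p ℕ.+ proj₂ q ≡ proj₁ q ℕ.+ proj₂ p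
      ; _+_     = λ (m , n) (m′ , n′) → reduce (m ℕ.+ m′ , n ℕ.+ n′)
      ; _*_     = λ (m , n) (m′ , n′) → reduce (m ℕ.* m′ ℕ.+ n ℕ.* n′ , m ℕ.* n′ ℕ.+ n ℕ.* m′)
      ; -_      = λ (m , n) → n , m
      ; 0#      = 0 , 0
      ; 1#      = 1 , 0
      }

    ·1-homo-*+* : ∀ m n m′ n′ →
      (m ℕ.* m′ ℕ.+ n ℕ.* n′) · 1# ≈ (m · 1#) * (m′ · 1#) + (n · 1#) * (n′ · 1#)
    ·1-homo-*+* m n m′ n′ =
      trans (×-homo-+ 1# (m ℕ.* m′) (n ℕ.* n′)) (+-cong (×1-homo-* m m′) (×1-homo-* n n′))

    [a-b][c-d] : ∀ a b c d → (a - b) * (c - d) ≈ (a * c + b * d) - (a * d + b * c)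
    [a-b][c-d] a b c d = begin
      (a - b) * (c - d)                         ≈⟨ Free.solve 4 (λ a b′ c d′ →
        (a :+ b′) :* (c :+ d′) := (a :* c :+ b′ :* d′) :+ (a :* d′ :+ b′ :* c)) refl a (- b) c (- d) ⟩
      (a * c + - b * - d) + (a * - d + - b * c) ≈⟨ +-cong (+-congˡ -b*-d≈b*d) (+-cong (sym (-‿distribʳ-* a d)) (sym (-‿distribˡ-* b c))) ⟩
      (a * c + b * d) + (- (a * d) - b * c)     ≈⟨ +-congˡ (-‿+-comm (a * d) (b * c)) ⟩
      (a * c + b * d) - (a * d + b * c)         ∎
      where
      open ≈-Reasoning setoid
      -b*-d≈b*d : - b * - d ≈ b * d
      -b*-d≈b*d = trans (sym (-‿distribˡ-* b (- d)))
        (trans (-‿cong (sym (-‿distribʳ-* b d))) (-‿involutive (b * d)))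

    difference-cong : ∀ p q → proj₁ p ℕ.+ proj₂ q ≡ proj₁ q ℕ.+ proj₂ p → difference p ≈ difference q
    difference-cong (m , n) (m′ , n′) eq = begin
      m · 1# - n · 1#                       ≈⟨ +-identityʳ _ ⟨
      m · 1# - n · 1# + 0#                  ≈⟨ +-congˡ (-‿inverseʳ (n′ · 1#)) ⟨
      m · 1# - n · 1# + (n′ · 1# - n′ · 1#) ≈⟨ Free.solve 3 (λ m n n′ →
        m :- n :+ (n′ :- n′) := m :+ n′ :- (n :+ n′)) refl (m · 1#) (n · 1#) (n′ · 1#) ⟩
      m · 1# + n′ · 1# - (n · 1# + n′ · 1#) ≈⟨ +-congʳ (×-homo-+ 1# m n′) ⟨
      (m ℕ.+ n′) · 1# - (n · 1# + n′ · 1#)  ≡⟨ ≡.cong (λ k → k · 1# - (n · 1# + n′ · 1#)) eq ⟩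
      (m′ ℕ.+ n) · 1# - (n · 1# + n′ · 1#)  ≈⟨ +-congʳ (×-homo-+ 1# m′ n) ⟩
      m′ · 1# + n · 1# - (n · 1# + n′ · 1#) ≈⟨ Free.solve 3 (λ m′ n n′ →
        m′ :+ n :- (n :+ n′) := m′ :- n′ :+ (n :- n)) refl (m′ · 1#) (n · 1#) (n′ · 1#) ⟩
      m′ · 1# - n′ · 1# + (n · 1# - n · 1#) ≈⟨ +-congˡ (-‿inverseʳ (n · 1#)) ⟩
      m′ · 1# - n′ · 1# + 0#                ≈⟨ +-identityʳ _ ⟩
      m′ · 1# - n′ · 1#                     ∎
      where open ≈-Reasoning setoid

    m∸n+n≡m+[n∸m] : ∀ m n → (m ∸ n) ℕ.+ n ≡ m ℕ.+ (n ∸ m)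
    m∸n+n≡m+[n∸m] zero    zero    = ≡.refl
    m∸n+n≡m+[n∸m] zero    (suc n) = ≡.refl
    m∸n+n≡m+[n∸m] (suc m) zero    = ≡.refl
    m∸n+n≡m+[n∸m] (suc m) (suc n) = ≡.trans (ℕ.+-suc (m ∸ n) n) (≡.cong suc (m∸n+n≡m+[n∸m] m n))

    difference-reduce : ∀ p → difference (reduce p) ≈ difference p
    difference-reduce (m , n) = difference-cong (reduce (m , n)) (m , n) (m∸n+n≡m+[n∸m] m n)

    -- Chosen so that the constants 0 and 1 of the solver denote 0# and 1#
    -- definitionally.
    ⟦_⟧ : ℕ × ℕ → Carrier
    ⟦ 0 , 0 ⟧ = 0#
    ⟦ 1 , 0 ⟧ = 1#
    ⟦ p ⟧     = difference p

    ⟦⟧≈difference : ∀ p → ⟦ p ⟧ ≈ difference p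
    ⟦⟧≈difference (0 , 0)           = sym (-‿inverseʳ 0#)
    ⟦⟧≈difference (0 , suc n)       = refl
    ⟦⟧≈difference (1 , 0)           = sym (trans (+-assoc 1# 0# (- 0#)) (trans (+-congˡ (-‿inverseʳ 0#)) (+-identityʳ 1#)))
    ⟦⟧≈difference (1 , suc n)       = refl
    ⟦⟧≈difference (suc (suc m) , n) = refl

    ⟦⟧-reduce : ∀ p → ⟦ reduce p ⟧ ≈ difference p
    ⟦⟧-reduce p = trans (⟦⟧≈difference (reduce p)) (difference-reduce p)

    ⟦⟧-homo : ℕ-differences -Raw-AlmostCommutative⟶ ACR
    ⟦⟧-homo = record
      { ⟦_⟧    = ⟦_⟧
      ; +-homo = λ p@(m , n) q@(m′ , n′) → begin
          ⟦ reduce (m ℕ.+ m′ , n ℕ.+ n′) ⟧        ≈⟨ ⟦⟧-reduce (m ℕ.+ m′ , n ℕ.+ n′) ⟩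
          (m ℕ.+ m′) · 1# - (n ℕ.+ n′) · 1#       ≈⟨ +-cong (×-homo-+ 1# m m′) (-‿cong (×-homo-+ 1# n n′)) ⟩
          (m · 1# + m′ · 1#) - (n · 1# + n′ · 1#) ≈⟨ Free.solve 4 (λ m n m′ n′ →
            (m :+ m′) :- (n :+ n′) := (m :- n) :+ (m′ :- n′))
            refl (m · 1#) (n · 1#) (m′ · 1#) (n′ · 1#) ⟩
          difference p + difference q             ≈⟨ +-cong (⟦⟧≈difference p) (⟦⟧≈difference q) ⟨
          ⟦ p ⟧ + ⟦ q ⟧                           ∎
      ; *-homo = λ p@(m , n) q@(m′ , n′) → begin
          ⟦ reduce (m ℕ.* m′ ℕ.+ n ℕ.* n′ , m ℕ.* n′ ℕ.+ n ℕ.* m′) ⟧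
            ≈⟨ ⟦⟧-reduce (m ℕ.* m′ ℕ.+ n ℕ.* n′ , m ℕ.* n′ ℕ.+ n ℕ.* m′) ⟩
          (m ℕ.* m′ ℕ.+ n ℕ.* n′) · 1# - (m ℕ.* n′ ℕ.+ n ℕ.* m′) · 1#
            ≈⟨ +-cong (·1-homo-*+* m n m′ n′) (-‿cong (·1-homo-*+* m n n′ m′)) ⟩
          ((m · 1#) * (m′ · 1#) + (n · 1#) * (n′ · 1#)) - ((m · 1#) * (n′ · 1#) + (n · 1#) * (m′ · 1#))
            ≈⟨ [a-b][c-d] (m · 1#) (n · 1#) (m′ · 1#) (n′ · 1#) ⟨
          difference p * difference q
            ≈⟨ *-cong (⟦⟧≈difference p) (⟦⟧≈difference q) ⟨
          ⟦ p ⟧ * ⟦ q ⟧ ∎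
      ; -‿homo = λ p@(m , n) → begin
          ⟦ n , m ⟧       ≈⟨ ⟦⟧≈difference (n , m) ⟩
          n · 1# - m · 1# ≈⟨ ⁻¹-anti-homo-// (m · 1#) (n · 1#) ⟨
          - difference p  ≈⟨ -‿cong (⟦⟧≈difference p) ⟨
          - ⟦ p ⟧         ∎
      ; 0-homo = refl
      ; 1-homo = refl
      }
      where open ≈-Reasoning setoid

    _≟ᵈ_ : ∀ p q → Maybe (⟦ p ⟧ ≈ ⟦ q ⟧)
    p ≟ᵈ q with proj₁ p ℕ.+ proj₂ q ℕ.≟ proj₁ q ℕ.+ proj₂ p
    ... | yes eq = just (trans (⟦⟧≈difference p) (trans (difference-cong p q eq) (sym (⟦⟧≈difference q))))
    ... | no  _  = nothing

  open RingSolver ℕ-differences ACR ⟦⟧-homo _≟ᵈ_ public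
    using (solve; con; _:+_; _:*_; _:-_; :-_; _:=_; Polynomial)

  :0 :1 : ∀ {n} → Polynomial n
  :0 = con (0 , 0)
  :1 = con (1 , 0)

-- Order, reciprocals and bounds in the field

module OrderedField {c ℓ₁ ℓ₂} (ℝ : RealField c ℓ₁ ℓ₂) where
  open RealField ℝ hiding (zero)
  open Analysis ℝ
  open IsStrictPartialOrder isStrictPartialOrder
    using (<-respʳ-≈; <-respˡ-≈; irrefl; asym)
    renaming (trans to <-trans)
  open IntegerRingSolver commutativeRing
  open HeytingProperties heytingCommutativeRing using (invertibleʳ⇒#; x-0≈x)

  private variable
    x y z w u v : Carrier

  -- The constructive substitute for trichotomy, inherited from cotransitivity of apartness. It
  -- makes the mixed transitivity laws work although `≤` is only a negation.
  <-cotrans : x < y → ∀ z → x < z ⊎ z < y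
  <-cotrans x<y z with #-cotrans (<⇒# x<y) z
  ... | inj₁ x#z with #⇒<⊎> x#z
  ...   | inj₁ x<z = inj₁ x<z
  ...   | inj₂ z<x = inj₂ (<-trans z<x x<y)
  <-cotrans x<y z | inj₂ z#y with #⇒<⊎> z#y
  ...   | inj₁ z<y = inj₂ z<y
  ...   | inj₂ y<z = inj₁ (<-trans x<y y<z)

  <⇒≤ : x < y → x ≤ y
  <⇒≤ = asym

  ≤-refl : x ≤ x
  ≤-refl = irrefl refl

  ≤-reflexive : x ≈ y → x ≤ y
  ≤-reflexive x≈y = irrefl (sym x≈y)

  <-≤-trans : x < y → y ≤ z → x < z
  <-≤-trans {z = z} x<y y≤z with <-cotrans x<y z
  ... | inj₁ x<z = x<z
  ... | inj₂ z<y = contradiction z<y y≤z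

  ≤-<-trans : x ≤ y → y < z → x < z
  ≤-<-trans {x = x} x≤y y<z with <-cotrans y<z x
  ... | inj₁ y<x = contradiction y<x x≤y
  ... | inj₂ x<z = x<z

  ≤-trans : x ≤ y → y ≤ z → x ≤ z
  ≤-trans x≤y y≤z z<x = x≤y (≤-<-trans y≤z z<x)

  ≤-antisym : x ≤ y → y ≤ x → x ≈ y
  ≤-antisym {x} {y} x≤y y≤x = proj₁ (tight x y) λ x#y → case (#⇒<⊎> x#y)
    where
    case : ¬ (x < y ⊎ y < x)
    case (inj₁ x<y) = y≤x x<y
    case (inj₂ y<x) = x≤y y<x

  ≤-respˡ-≈ : x ≈ y → x ≤ z → y ≤ z
  ≤-respˡ-≈ x≈y = ≤-trans (≤-reflexive (sym x≈y))

  ≤-respʳ-≈ : x ≈ y → z ≤ x → z ≤ y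
  ≤-respʳ-≈ x≈y z≤x = ≤-trans z≤x (≤-reflexive x≈y)

  -- Totality in continuation form: a goal that is `⊥` may be split according to the order of two
  -- reals.
  ¬¬≤-total : ∀ x y → (x ≤ y → ⊥) → (y ≤ x → ⊥) → ⊥
  ¬¬≤-total x y x≰y y≰x = x≰y λ y<x → y≰x (asym y<x)

  x<y⇒0<y-x : x < y → 0# < y - x
  x<y⇒0<y-x {x} x<y = <-respˡ-≈ (-‿inverseʳ x) (+-monoˡ-< (- x) x<y)

  0<y-x⇒x<y : 0# < y - x → x < y
  0<y-x⇒x<y {y} {x} 0<y-x = <-respˡ-≈ (+-identityˡ x)
    (<-respʳ-≈ (solve 2 (λ x y → y :- x :+ x := y) refl x y) (+-monoˡ-< x 0<y-x))

  x≤y⇒0≤y-x : x ≤ y → 0# ≤ y - x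
  x≤y⇒0≤y-x {x} {y} x≤y y-x<0 = x≤y (<-respˡ-≈ (solve 2 (λ x y → y :- x :+ x := y) refl x y)
    (<-respʳ-≈ (+-identityˡ x) (+-monoˡ-< x y-x<0)))

  0≤y-x⇒x≤y : 0# ≤ y - x → x ≤ y
  0≤y-x⇒x≤y {y} {x} 0≤y-x y<x = 0≤y-x (<-respʳ-≈ (-‿inverseʳ x) (+-monoˡ-< (- x) y<x))

  -- The standard form of the estimates below: a visibly nonnegative expression, and a ring identity
  -- equating it with the difference of the two sides.
  0≤⇒≤ : 0# ≤ z → z ≈ y - x → x ≤ y
  0≤⇒≤ 0≤z z≈y-x = 0≤y-x⇒x≤y (≤-respʳ-≈ z≈y-x 0≤z)

  0<⇒< : 0# < z → z ≈ y - x → x < y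
  0<⇒< 0<z z≈y-x = 0<y-x⇒x<y (<-respʳ-≈ z≈y-x 0<z)

  0<x+y : 0# < x → 0# ≤ y → 0# < x + y
  0<x+y {x} {y} 0<x 0≤y = <-≤-trans 0<x
    (0≤⇒≤ 0≤y (solve 2 (λ x y → y := x :+ y :- x) refl x y))

  0≤x+y : 0# ≤ x → 0# ≤ y → 0# ≤ x + y
  0≤x+y {x} {y} 0≤x 0≤y = ≤-trans 0≤x
    (0≤⇒≤ 0≤y (solve 2 (λ x y → y := x :+ y :- x) refl x y))

  -- The goal is a negation, so each factor may be taken to be either positive or zero.
  0≤x*y : 0# ≤ x → 0# ≤ y → 0# ≤ x * y
  0≤x*y {x} {y} 0≤x 0≤y xy<0 = nonpositive 0≤x (λ 0<x → nonpositive 0≤y (λ 0<y →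
      asym xy<0 (*-pos 0<x 0<y))
      λ y≈0 → irrefl (trans (*-congˡ y≈0) (zeroʳ x)) xy<0)
      λ x≈0 → irrefl (trans (*-congʳ x≈0) (zeroˡ y)) xy<0
    where
    nonpositive : 0# ≤ z → (0# < z → ⊥) → (z ≈ 0# → ⊥) → ⊥
    nonpositive 0≤z 0≮z z≉0 = z≉0 (≤-antisym 0≮z 0≤z)

  0≤x+x⇒0≤x : 0# ≤ x + x → 0# ≤ x
  0≤x+x⇒0≤x {x} 0≤x+x x<0 = 0≤x+x (<-trans (<-respʳ-≈ (+-identityˡ x) (+-monoˡ-< x x<0)) x<0)

  0≤x*x : ∀ x → 0# ≤ x * x
  0≤x*x x x²<0 = ¬¬≤-total 0# x (λ 0≤x → 0≤x*y 0≤x 0≤x x²<0)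
    (λ x≤0 → 0≤x*y (x≤y⇒0≤y-x x≤0) (x≤y⇒0≤y-x x≤0)
      (<-respˡ-≈ (solve 1 (λ x → x :* x := (:0 :- x) :* (:0 :- x)) refl x) x²<0))

  *-monoˡ-<-pos : 0# < z → x < y → x * z < y * z
  *-monoˡ-<-pos {z} {x} {y} 0<z x<y = 0<⇒< (*-pos (x<y⇒0<y-x x<y) 0<z)
    (solve 3 (λ x y z → (y :- x) :* z := y :* z :- x :* z) refl x y z)

  *-inverseʳ : ∀ x x#0 → x * inverse x x#0 ≈ 1#
  *-inverseʳ x x#0 = trans (*-congʳ (sym (x-0≈x x))) (proj₂ (proj₂ (#⇒invertible x#0)))

  *-reciprocal : ∀ x 0<x → x * reciprocal x 0<x ≈ 1#
  *-reciprocal x 0<x = *-inverseʳ x (#0 0<x)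

  -- Being invertible, the reciprocal is apart from zero; if it were negative, multiplying by `x`
  -- would give 1 < 0.
  0<reciprocal : ∀ x 0<x → 0# < reciprocal x 0<x
  0<reciprocal x 0<x with #⇒<⊎> (invertibleʳ⇒# (x ,
    trans (*-congʳ (x-0≈x _)) (trans (*-comm _ x) (*-reciprocal x 0<x))))
  ... | inj₂ 0<r = 0<r
  ... | inj₁ r<0 = contradiction
    (<-respʳ-≈ (zeroˡ x) (<-respˡ-≈ (trans (*-comm _ x) (*-reciprocal x 0<x)) (*-monoˡ-<-pos 0<x r<0)))
    (<⇒≤ 0<1)

  reciprocal-difference : ∀ u 0<u v 0<v →
    reciprocal u 0<u - reciprocal v 0<v ≈ (v - u) * (reciprocal u 0<u * reciprocal v 0<v)
  reciprocal-difference u 0<u v 0<v = begin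
    u⁻¹ - v⁻¹                         ≈⟨ +-cong (*-identityʳ u⁻¹) (-‿cong (*-identityʳ v⁻¹)) ⟨
    u⁻¹ * 1# - v⁻¹ * 1#               ≈⟨ +-cong (*-congˡ (*-reciprocal v 0<v)) (-‿cong (*-congˡ (*-reciprocal u 0<u))) ⟨
    u⁻¹ * (v * v⁻¹) - v⁻¹ * (u * u⁻¹) ≈⟨ solve 4 (λ u v u⁻¹ v⁻¹ →
      u⁻¹ :* (v :* v⁻¹) :- v⁻¹ :* (u :* u⁻¹) := (v :- u) :* (u⁻¹ :* v⁻¹)) refl u v u⁻¹ v⁻¹ ⟩
    (v - u) * (u⁻¹ * v⁻¹)             ∎
    where
    open ≈-Reasoning setoid
    u⁻¹ = reciprocal u 0<u
    v⁻¹ = reciprocal v 0<v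

  -- Applied to a single point, this gives independence of the positivity proof.
  reciprocal-cong : ∀ {u v} 0<u 0<v → u ≈ v → reciprocal u 0<u ≈ reciprocal v 0<v
  reciprocal-cong {u} {v} 0<u 0<v u≈v = begin
    u⁻¹                           ≈⟨ solve 2 (λ x y → x := x :- y :+ y) refl u⁻¹ v⁻¹ ⟩
    u⁻¹ - v⁻¹ + v⁻¹               ≈⟨ +-congʳ (reciprocal-difference u 0<u v 0<v) ⟩
    (v - u) * (u⁻¹ * v⁻¹) + v⁻¹   ≈⟨ +-congʳ (*-congʳ (+-congʳ u≈v)) ⟨
    (u - u) * (u⁻¹ * v⁻¹) + v⁻¹   ≈⟨ solve 3 (λ u x y → (u :- u) :* (x :* y) :+ y := y) refl u u⁻¹ v⁻¹ ⟩
    v⁻¹                           ∎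
    where
    open ≈-Reasoning setoid
    u⁻¹ = reciprocal u 0<u
    v⁻¹ = reciprocal v 0<v

  0<1+1 : 0# < 1# + 1#
  0<1+1 = 0<x+y 0<1 (<⇒≤ 0<1)

  ½ : Carrier
  ½ = reciprocal (1# + 1#) 0<1+1

  0<½x : 0# < x → 0# < ½ * x
  0<½x = *-pos (0<reciprocal _ 0<1+1)

  ½x+½x≈x : ∀ x → ½ * x + ½ * x ≈ x
  ½x+½x≈x x = trans (solve 2 (λ h x → h :* x :+ h :* x := (:1 :+ :1) :* h :* x) refl ½ x)
    (trans (*-congʳ (*-reciprocal _ 0<1+1)) (*-identityˡ x))

  -- Half the gap serves as `ε`. The slack is `ε + ε` because two approximations are combined in
  -- each use, and the double negation admits approximations found by classical case distinction.
  ≤-limit : ∀ {x y} → (∀ ε → 0# < ε → ¬ ¬ (x - y < ε + ε)) → x ≤ y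
  ≤-limit {x} {y} approx y<x = approx (½ * (x - y)) (0<½x (x<y⇒0<y-x y<x))
    λ x-y<2ε → irrefl (sym (½x+½x≈x (x - y))) x-y<2ε

  -- Integrals run both ways; indexing the order by a direction lets one argument serve ascending
  -- and descending partitions.
  data Direction : Set where
    up down : Direction

  infix 4 _≤[_]_
  _≤[_]_ : Carrier → Direction → Carrier → Set ℓ₂
  x ≤[ up ] y   = x ≤ y
  x ≤[ down ] y = y ≤ x

  ≤[]-refl : ∀ d → x ≤[ d ] x
  ≤[]-refl up   = ≤-refl
  ≤[]-refl down = ≤-refl

  ≤[]-trans : ∀ d → x ≤[ d ] y → y ≤[ d ] z → x ≤[ d ] z
  ≤[]-trans up   x≤y y≤z = ≤-trans x≤y y≤z
  ≤[]-trans down x≥y y≥z = ≤-trans y≥z x≥y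

  ≤[]-respʳ-≈ : ∀ d → x ≈ y → z ≤[ d ] x → z ≤[ d ] y
  ≤[]-respʳ-≈ up   = ≤-respʳ-≈
  ≤[]-respʳ-≈ down = ≤-respˡ-≈

  ¬¬≤[]-total : ∀ x y → (∀ d → x ≤[ d ] y → ⊥) → ⊥
  ¬¬≤[]-total x y ≰ = ¬¬≤-total x y (≰ up) (≰ down)

  0≤product : ∀ d → x ≤[ d ] y → u ≤[ d ] v → 0# ≤ (y - x) * (v - u)
  0≤product up   x≤y u≤v = 0≤x*y (x≤y⇒0≤y-x x≤y) (x≤y⇒0≤y-x u≤v)
  0≤product {x} {y} {u} {v} down y≤x v≤u = ≤-respʳ-≈
    (solve 4 (λ x y u v → (x :- y) :* (u :- v) := (y :- x) :* (v :- u)) refl x y u v)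
    (0≤x*y (x≤y⇒0≤y-x y≤x) (x≤y⇒0≤y-x v≤u))

  infix 4 ∣_∣≤_
  ∣_∣≤_ : Carrier → Carrier → Set ℓ₂
  ∣ x ∣≤ b = 0# ≤ b - x × 0# ≤ b + x

  ∣∣≤-cong : x ≈ y → ∣ x ∣≤ z → ∣ y ∣≤ z
  ∣∣≤-cong x≈y (p , q) = ≤-respʳ-≈ (+-congˡ (-‿cong x≈y)) p , ≤-respʳ-≈ (+-congˡ x≈y) q

  ∣∣≤-respʳ : z ≈ w → ∣ x ∣≤ z → ∣ x ∣≤ w
  ∣∣≤-respʳ z≈w (p , q) = ≤-respʳ-≈ (+-congʳ z≈w) p , ≤-respʳ-≈ (+-congʳ z≈w) q

  ∣∣≤-+ : ∣ x ∣≤ u → ∣ y ∣≤ v → ∣ x + y ∣≤ u + v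
  ∣∣≤-+ {x} {u} {y} {v} (p , q) (p′ , q′) =
    ≤-respʳ-≈ (solve 4 (λ x u y v → (u :- x) :+ (v :- y) := u :+ v :- (x :+ y)) refl x u y v) (0≤x+y p p′) ,
    ≤-respʳ-≈ (solve 4 (λ x u y v → (u :+ x) :+ (v :+ y) := u :+ v :+ (x :+ y)) refl x u y v) (0≤x+y q q′)

  ∣∣≤-neg : ∣ x ∣≤ u → ∣ - x ∣≤ u
  ∣∣≤-neg {x} {u} (p , q) =
    ≤-respʳ-≈ (solve 2 (λ x u → u :+ x := u :- :- x) refl x u) q , p

  -- Twice each required difference is a sum of two products of the given nonnegative quantities,
  -- such as 2(uv - xy) = (u - x)(v + y) + (u + x)(v - y). No signs need to be distinguished.
  ∣∣≤-* : ∣ x ∣≤ u → ∣ y ∣≤ v → ∣ x * y ∣≤ u * v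
  ∣∣≤-* {x} {u} {y} {v} (p , q) (p′ , q′) =
    0≤x+x⇒0≤x (≤-respʳ-≈ (solve 4 (λ x u y v →
      (u :- x) :* (v :+ y) :+ (u :+ x) :* (v :- y) := (u :* v :- x :* y) :+ (u :* v :- x :* y))
      refl x u y v) (0≤x+y (0≤x*y p q′) (0≤x*y q p′))) ,
    0≤x+x⇒0≤x (≤-respʳ-≈ (solve 4 (λ x u y v →
      (u :- x) :* (v :- y) :+ (u :+ x) :* (v :+ y) := (u :* v :+ x :* y) :+ (u :* v :+ x :* y))
      refl x u y v) (0≤x+y (0≤x*y p p′) (0≤x*y q q′)))

  -- A polynomial bound used in place of the absolute value; it follows from 2(1 + x² - x) = 1 + x²
  -- + (x - 1)² and its mirror image.
  ∣x∣≤1+x² : ∀ x → ∣ x ∣≤ 1# + x * x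
  ∣x∣≤1+x² x =
    0≤x+x⇒0≤x (≤-respʳ-≈ (solve 1 (λ x → :1 :+ (x :* x :+ (x :- :1) :* (x :- :1))
      := (:1 :+ x :* x :- x) :+ (:1 :+ x :* x :- x)) refl x)
      (0≤x+y (<⇒≤ 0<1) (0≤x+y (0≤x*x x) (0≤x*x (x - 1#))))) ,
    0≤x+x⇒0≤x (≤-respʳ-≈ (solve 1 (λ x → :1 :+ (x :* x :+ (x :+ :1) :* (x :+ :1))
      := (:1 :+ x :* x :+ x) :+ (:1 :+ x :* x :+ x)) refl x)
      (0≤x+y (<⇒≤ 0<1) (0≤x+y (0≤x*x x) (0≤x*x (x + 1#)))))

  ∣∣≤⇒0≤ : ∣ x ∣≤ u → 0# ≤ u
  ∣∣≤⇒0≤ {x} {u} (p , q) = 0≤x+x⇒0≤x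
    (≤-respʳ-≈ (solve 2 (λ x u → (u :- x) :+ (u :+ x) := u :+ u) refl x u) (0≤x+y p q))

-- Differentiation with uniform quadratic error

module Differentiation {c ℓ₁ ℓ₂} (ℝ : RealField c ℓ₁ ℓ₂) where
  open RealField ℝ hiding (zero)
  open Analysis ℝ
  open OrderedField ℝ
  open IntegerRingSolver commutativeRing

  -- Points are elements of a type `X` lying over the reals, so that the proofs of membership needed
  -- to evaluate a partial function travel with them.
  module _ {p} {X : Set p} (ι : X → Carrier) where

    -- Differentiability with uniform quadratic error.  Quantifying over bounds e
    -- of the increment avoids absolute values, which need not exist constructively.
    record HasDerivative (G g : X → Carrier) : Set (c ⊔ ℓ₂ ⊔ p) where
      field
        bound lipschitz curvature : Carrier
        bounded      : ∀ u → ∣ G u ∣≤ bound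
        isLipschitz  : ∀ u v {e} → ∣ ι v - ι u ∣≤ e → ∣ G v - G u ∣≤ lipschitz * e
        linearizable : ∀ u v {e} → ∣ ι v - ι u ∣≤ e →
                       ∣ G v - G u - g u * (ι v - ι u) ∣≤ curvature * (e * e)

    open HasDerivative

    resp-≈ : ∀ {G H g h} → (∀ u → G u ≈ H u) → (∀ u → g u ≈ h u) →
             HasDerivative G g → HasDerivative H h
    resp-≈ G≈H g≈h D = record
      { bound        = bound D
      ; lipschitz    = lipschitz D
      ; curvature    = curvature D
      ; bounded      = λ u → ∣∣≤-cong (G≈H u) (bounded D u)
      ; isLipschitz  = λ u v d → ∣∣≤-cong (G-G≈H-H u v) (isLipschitz D u v d)
      ; linearizable = λ u v d →
          ∣∣≤-cong (+-cong (G-G≈H-H u v) (-‿cong (*-congʳ (g≈h u)))) (linearizable D u v d)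
      }
      where
      G-G≈H-H = λ u v → +-cong (G≈H v) (-‿cong (G≈H u))

    const : ∀ k → HasDerivative (λ _ → k) (λ _ → 0#)
    const k = record
      { bound        = 1# + k * k
      ; lipschitz    = 0#
      ; curvature    = 0#
      ; bounded      = λ _ → ∣x∣≤1+x² k
      ; isLipschitz  = λ u v {e} _ →
          ≤-reflexive (solve 2 (λ k e → :0 := :0 :* e :- (k :- k)) refl k e) ,
          ≤-reflexive (solve 2 (λ k e → :0 := :0 :* e :+ (k :- k)) refl k e)
      ; linearizable = λ u v {e} _ →
          ≤-reflexive (solve 3 (λ k d e → :0 := :0 :* (e :* e) :- (k :- k :- :0 :* d)) refl k (ι v - ι u) e) ,
          ≤-reflexive (solve 3 (λ k d e → :0 := :0 :* (e :* e) :+ (k :- k :- :0 :* d)) refl k (ι v - ι u) e)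
      }

    identity : ∀ {w} → (∀ u → ∣ ι u ∣≤ w) → HasDerivative ι (λ _ → 1#)
    identity {w} ∣ι∣≤w = record
      { bound        = w
      ; lipschitz    = 1#
      ; curvature    = 0#
      ; bounded      = ∣ι∣≤w
      ; isLipschitz  = λ u v {e} d → ∣∣≤-respʳ (sym (*-identityˡ e)) d
      ; linearizable = λ u v {e} _ →
          ≤-reflexive (solve 2 (λ d e → :0 := :0 :* (e :* e) :- (d :- :1 :* d)) refl (ι v - ι u) e) ,
          ≤-reflexive (solve 2 (λ d e → :0 := :0 :* (e :* e) :+ (d :- :1 :* d)) refl (ι v - ι u) e)
      }

    infixl 6 _+′_
    _+′_ : ∀ {G H g h} → HasDerivative G g → HasDerivative H h →
           HasDerivative (λ u → G u + H u) (λ u → g u + h u)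
    _+′_ {G} {H} {g} {h} DG DH = record
      { bound        = bound DG + bound DH
      ; lipschitz    = lipschitz DG + lipschitz DH
      ; curvature    = curvature DG + curvature DH
      ; bounded      = λ u → ∣∣≤-+ (bounded DG u) (bounded DH u)
      ; isLipschitz  = λ u v {e} d →
          ∣∣≤-respʳ (sym (distribʳ e (lipschitz DG) (lipschitz DH)))
          (∣∣≤-cong (solve 4 (λ G G′ H H′ → (G′ :- G) :+ (H′ :- H) := (G′ :+ H′) :- (G :+ H))
              refl (G u) (G v) (H u) (H v))
            (∣∣≤-+ (isLipschitz DG u v d) (isLipschitz DH u v d)))
      ; linearizable = λ u v {e} d →
          ∣∣≤-respʳ (sym (distribʳ (e * e) (curvature DG) (curvature DH)))
          (∣∣≤-cong (solve 7 (λ G G′ H H′ g h d →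
              (G′ :- G :- g :* d) :+ (H′ :- H :- h :* d) := (G′ :+ H′) :- (G :+ H) :- (g :+ h) :* d)
              refl (G u) (G v) (H u) (H v) (g u) (h u) (ι v - ι u))
            (∣∣≤-+ (linearizable DG u v d) (linearizable DH u v d)))
      }

    infixl 7 _*′_
    -- The error splits into the two linearization errors, weighted by the factors, and the product
    -- of both increments. Bounds control the weights; the two Lipschitz constants make the last
    -- term quadratic.
    _*′_ : ∀ {G H g h} → HasDerivative G g → HasDerivative H h →
           HasDerivative (λ u → G u * H u) (λ u → g u * H u + G u * h u)
    _*′_ {G} {H} {g} {h} DG DH = record
      { bound        = bound DG * bound DH
      ; lipschitz    = bound DH * lipschitz DG + bound DG * lipschitz DH
      ; curvature    = bound DH * curvature DG + bound DG * curvature DH + lipschitz DG * lipschitz DH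
      ; bounded      = λ u → ∣∣≤-* (bounded DG u) (bounded DH u)
      ; isLipschitz  = λ u v {e} d →
          ∣∣≤-respʳ (solve 5 (λ B L B′ L′ e → B :* (L :* e) :+ B′ :* (L′ :* e)
              := (B :* L :+ B′ :* L′) :* e)
              refl (bound DH) (lipschitz DG) (bound DG) (lipschitz DH) e)
          (∣∣≤-cong (solve 4 (λ G G′ H H′ →
              H′ :* (G′ :- G) :+ G :* (H′ :- H) := G′ :* H′ :- G :* H)
              refl (G u) (G v) (H u) (H v))
            (∣∣≤-+ (∣∣≤-* (bounded DH v) (isLipschitz DG u v d))
                   (∣∣≤-* (bounded DG u) (isLipschitz DH u v d))))
      ; linearizable = λ u v {e} d →
          ∣∣≤-respʳ (solve 7 (λ B M B′ M′ L L′ e →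
              B :* (M :* (e :* e)) :+ B′ :* (M′ :* (e :* e)) :+ (L :* e) :* (L′ :* e)
              := (B :* M :+ B′ :* M′ :+ L :* L′) :* (e :* e))
              refl (bound DH) (curvature DG) (bound DG) (curvature DH) (lipschitz DG) (lipschitz DH) e)
          (∣∣≤-cong (solve 7 (λ G G′ H H′ g h d →
              H :* (G′ :- G :- g :* d) :+ G :* (H′ :- H :- h :* d) :+ (G′ :- G) :* (H′ :- H)
              := G′ :* H′ :- G :* H :- (g :* H :+ G :* h) :* d)
              refl (G u) (G v) (H u) (H v) (g u) (h u) (ι v - ι u))
            (∣∣≤-+ (∣∣≤-+ (∣∣≤-* (bounded DH u) (linearizable DG u v d))
                          (∣∣≤-* (bounded DG u) (linearizable DH u v d)))
                   (∣∣≤-* (isLipschitz DG u v d) (isLipschitz DH u v d))))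
      }

    infixr 7 _*ₗ_
    _*ₗ_ : ∀ k {G g} → HasDerivative G g → HasDerivative (λ u → k * G u) (λ u → k * g u)
    _*ₗ_ k {G} {g} DG = resp-≈ (λ _ → refl)
      (λ u → solve 3 (λ k G g → :0 :* G :+ k :* g := k :* g) refl k (G u) (g u))
      (const k *′ DG)

    power : ∀ {w} → (∀ u → ∣ ι u ∣≤ w) → ∀ n →
            HasDerivative (λ u → ι u ^ suc n) (λ u → (suc n · 1#) * ι u ^ n)
    power ∣ι∣≤w zero = resp-≈ (λ u → sym (*-identityʳ (ι u)))
      (λ _ → solve 0 (:1 := (:1 :+ :0) :* :1) refl) (identity ∣ι∣≤w)
    power ∣ι∣≤w (suc n) = resp-≈ (λ _ → refl)
      (λ u → solve 3 (λ x p n → :1 :* (x :* p) :+ x :* (n :* p) := (:1 :+ n) :* (x :* p))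
        refl (ι u) (ι u ^ n) (suc n · 1#))
      (identity ∣ι∣≤w *′ power ∣ι∣≤w n)

    -- The Lipschitz estimate with increment bound zero. It identifies values at points that agree
    -- only up to `≈` or carry different membership proofs, as the end nodes of a partition do.
    extensional : ∀ {G g} → HasDerivative G g → ∀ u v → ι u ≈ ι v → G u ≈ G v
    extensional {G} DG u v ιu≈ιv = sym (≤-antisym
      (0≤⇒≤ (proj₁ Δ≤0) (solve 3 (λ G G′ L → L :* :0 :- (G′ :- G) := G :- G′) refl (G u) (G v) (lipschitz DG)))
      (0≤⇒≤ (proj₂ Δ≤0) (solve 3 (λ G G′ L → L :* :0 :+ (G′ :- G) := G′ :- G) refl (G u) (G v) (lipschitz DG))))
      where
      Δ≤0 : ∣ G v - G u ∣≤ lipschitz DG * 0#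
      Δ≤0 = isLipschitz DG u v
        (≤-reflexive (trans (solve 1 (λ x → :0 := :0 :- (x :- x)) refl (ι v)) (+-congˡ (-‿cong (+-congˡ (-‿cong (sym ιu≈ιv)))))) ,
         ≤-reflexive (trans (solve 1 (λ x → :0 := :0 :+ (x :- x)) refl (ι v)) (+-congˡ (+-congˡ (-‿cong (sym ιu≈ιv))))))

    -- Linearization from `u` to itself with increment bound 1. A point is required because on an
    -- empty `X` every constant would qualify.
    curvature-nonneg : ∀ {G g} (DG : HasDerivative G g) → X → 0# ≤ curvature DG
    curvature-nonneg DG u = ≤-respʳ-≈ (solve 1 (λ M → M :* (:1 :* :1) := M) refl (curvature DG))
      (∣∣≤⇒0≤ (linearizable DG u u
        (≤-trans (<⇒≤ 0<1) (≤-reflexive (solve 1 (λ x → :1 := :1 :- (x :- x)) refl (ι u))) ,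
         ≤-trans (<⇒≤ 0<1) (≤-reflexive (solve 1 (λ x → :1 := :1 :+ (x :- x)) refl (ι u))))))

-- Riemann sums against an antiderivative

module FundamentalTheorem {c ℓ₁ ℓ₂} (ℝ : RealField c ℓ₁ ℓ₂) where
  open RealField ℝ hiding (zero)
  open Analysis ℝ
  open OrderedField ℝ
  open Differentiation ℝ
  open IntegerRingSolver commutativeRing

  -- For use with `φ` the antiderivative at the nodes, `π` their signed positions and `ρ` the
  -- Riemann terms: errors proportional to cell length add up to one proportional to total length.
  telescope : ∀ {n} (φ π : Fin (suc n) → Carrier) (ρ : Fin n → Carrier) κ →
    (∀ i → ∣ φ (suc i) - φ (inject₁ i) - ρ i ∣≤ κ * (π (suc i) - π (inject₁ i))) →
    ∣ φ (fromℕ n) - φ zero - sum ρ ∣≤ κ * (π (fromℕ n) - π zero)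
  telescope {zero} φ π ρ κ _ =
    ≤-reflexive (solve 3 (λ f p κ → :0 := κ :* (p :- p) :- (f :- f :- :0)) refl (φ zero) (π zero) κ) ,
    ≤-reflexive (solve 3 (λ f p κ → :0 := κ :* (p :- p) :+ (f :- f :- :0)) refl (φ zero) (π zero) κ)
  telescope {suc n} φ π ρ κ h =
    ∣∣≤-respʳ (solve 4 (λ κ a b c → κ :* (b :- a) :+ κ :* (c :- b) := κ :* (c :- a))
      refl κ (π zero) (π (suc zero)) (π (fromℕ (suc n))))
    (∣∣≤-cong (solve 5 (λ a b c r s → (b :- a :- r) :+ (c :- b :- s) := c :- a :- (r :+ s))
        refl (φ zero) (φ (suc zero)) (φ (fromℕ (suc n))) (ρ zero) (sum (λ i → ρ (suc i))))
      (∣∣≤-+ (h zero)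
        (telescope (λ j → φ (suc j)) (λ j → π (suc j)) (λ i → ρ (suc i)) κ (λ i → h (suc i)))))

  monotone : ∀ d {n} (point : Fin (suc n) → Carrier) →
    (∀ i → point (inject₁ i) ≤[ d ] point (suc i)) →
    ∀ j → point zero ≤[ d ] point j × point j ≤[ d ] point (fromℕ n)
  monotone d {zero}  point h zero    = ≤[]-refl d , ≤[]-refl d
  monotone d {suc n} point h zero    =
    ≤[]-refl d , ≤[]-trans d (h zero) (proj₂ (monotone d (λ j → point (suc j)) (λ i → h (suc i)) zero))
  monotone d {suc n} point h (suc j) =
    let left , right = monotone d (λ j → point (suc j)) (λ i → h (suc i)) j
    in ≤[]-trans d (h zero) left , right

  between : ∀ d {u v t} → u ≤[ d ] t → t ≤[ d ] v → Between u v t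
  between up   u≤t t≤v = inj₁ (u≤t , t≤v)
  between down t≤u v≤t = inj₂ (v≤t , t≤u)

  -- Positions are negated on descending partitions, so that cell lengths are nonnegative in either
  -- direction.
  signed : Direction → Carrier → Carrier
  signed up   x = x
  signed down x = - x

  0≤signed : ∀ d {x y} → x ≤[ d ] y → 0# ≤ signed d y - signed d x
  0≤signed up           x≤y = x≤y⇒0≤y-x x≤y
  0≤signed down {x} {y} y≤x = ≤-respʳ-≈ (solve 2 (λ x y → x :- y := :- y :- :- x) refl x y) (x≤y⇒0≤y-x y≤x)

  signed≤ : ∀ d {x y b} → ∣ y - x ∣≤ b → signed d y - signed d x ≤ b
  signed≤ up   {x} {y} {b} (p , _) = 0≤y-x⇒x≤y p
  signed≤ down {x} {y} {b} (_ , q) = 0≤⇒≤ q (solve 3 (λ x y b → b :+ (y :- x) := b :- (:- y :- :- x)) refl x y b)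

  ∣∣≤signed : ∀ d {x y} → x ≤[ d ] y → ∣ y - x ∣≤ signed d y - signed d x
  ∣∣≤signed up {x} {y} x≤y =
    ≤-reflexive (solve 2 (λ x y → :0 := y :- x :- (y :- x)) refl x y) ,
    0≤x+y (x≤y⇒0≤y-x x≤y) (x≤y⇒0≤y-x x≤y)
  ∣∣≤signed down {x} {y} y≤x =
    ≤-respʳ-≈ (solve 2 (λ x y → (x :- y) :+ (x :- y) := :- y :- :- x :- (y :- x)) refl x y)
      (0≤x+y (x≤y⇒0≤y-x y≤x) (x≤y⇒0≤y-x y≤x)) ,
    ≤-reflexive (solve 2 (λ x y → :0 := :- y :- :- x :+ (y :- x)) refl x y)

  ∣∣≤-mono : ∀ {x u v} → u ≤ v → ∣ x ∣≤ u → ∣ x ∣≤ v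
  ∣∣≤-mono {x} {u} {v} u≤v (p , q) =
    ≤-respʳ-≈ (solve 3 (λ x u v → (v :- u) :+ (u :- x) := v :- x) refl x u v) (0≤x+y (x≤y⇒0≤y-x u≤v) p) ,
    ≤-respʳ-≈ (solve 3 (λ x u v → (v :- u) :+ (u :+ x) := v :+ x) refl x u v) (0≤x+y (x≤y⇒0≤y-x u≤v) q)

  -- The positive slack `δ` turns a weak bound into the strict inequalities of `Close`.
  ∣∣≤⇒Close : ∀ {x y ε δ} → 0# < δ → ∣ x - y ∣≤ ε - δ → Close ε y x
  ∣∣≤⇒Close {x} {y} {ε} {δ} 0<δ (p , q) =
    0<⇒< (0<x+y 0<δ q) (solve 4 (λ x y ε δ → δ :+ (ε :- δ :+ (x :- y)) := ε :- (y :- x)) refl x y ε δ) ,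
    0<⇒< (0<x+y 0<δ p) (solve 4 (λ x y ε δ → δ :+ (ε :- δ :- (x :- y)) := ε :- (x :- y)) refl x y ε δ)

  Close⇒signed≤ : ∀ d {x y δ} → Close δ y x → signed d y - signed d x ≤ δ
  Close⇒signed≤ up           (p , _) = <⇒≤ p
  Close⇒signed≤ down {x} {y} (_ , q) =
    ≤-respˡ-≈ (solve 2 (λ x y → x :- y := :- y :- :- x) refl x y) (<⇒≤ q)

  direction : ∀ {u v} (P : TaggedPartition u v) → let open TaggedPartition P in
    Σ[ d ∈ Direction ] (∀ i → point (inject₁ i) ≤[ d ] tag i × tag i ≤[ d ] point (suc i))
  direction P with TaggedPartition.ordered P
  ... | inj₁ ascending  = up , ascending
  ... | inj₂ descending = down , λ i → proj₂ (descending i) , proj₁ (descending i)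

  module _ {p} (D : Carrier → Set p) (u v : Carrier) where

    -- Whether an endpoint lies between the endpoints is not decidable, hence the
    -- double negation.
    Segment : Set (c ⊔ ℓ₂ ⊔ p)
    Segment = Σ[ t ∈ Carrier ] (D t × ¬ ¬ Between u v t)

    segment-start : D u → Segment
    segment-start Du = u , Du , λ k → ¬¬≤[]-total u v λ d u≤v → k (between d (≤[]-refl d) u≤v)

    segment-end : D v → Segment
    segment-end Dv = v , Dv , λ k → ¬¬≤[]-total u v λ d u≤v → k (between d u≤v (≤[]-refl d))

  fundamental-theorem : ∀ {p} {D : Carrier → Set p} {u v} →
    (∀ t → Between u v t → D t) → ∀ Du Dv →
    ∀ {w} → ∣ v - u ∣≤ w →
    ∀ {G g} → HasDerivative proj₁ G g →
    ∀ (f : PartialFunction D) → (∀ t t∈D ¬¬btw → f t t∈D ≈ g (t , t∈D , ¬¬btw)) →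
    IsIntegral f u v (G (segment-end D u v Dv) - G (segment-start D u v Du))
  fundamental-theorem {D = D} {u} {v} segment⊆D Du Dv {w} ∣v-u∣≤w {G} {g} DG f f≈g =
    segment⊆D , λ ε 0<ε → δ ε , 0<δ ε 0<ε , λ P → close P ε 0<ε
    where
    M = HasDerivative.curvature DG

    0≤M+M : 0# ≤ M + M
    0≤M+M = 0≤x+y M≥0 M≥0
      where M≥0 = curvature-nonneg proj₁ DG (segment-start D u v Du)

    -- With `δ ε` equal to ε / C, the total error 2 M δ w is exactly ε - δ. The summand 1 makes `C`
    -- positive and leaves the slack δ that strictness requires.
    C : Carrier
    C = 1# + (M + M) * w

    0<C : 0# < C
    0<C = 0<x+y 0<1 (0≤x*y 0≤M+M (∣∣≤⇒0≤ ∣v-u∣≤w))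

    δ : Carrier → Carrier
    δ ε = ε * reciprocal C 0<C

    0<δ : ∀ ε → 0# < ε → 0# < δ ε
    0<δ ε 0<ε = *-pos 0<ε (0<reciprocal C 0<C)

    δ-total : ∀ ε → (M + M) * δ ε * w ≈ ε - δ ε
    δ-total ε = begin
      (M + M) * δ ε * w                  ≈⟨ solve 4 (λ M w ε C⁻¹ → (M :+ M) :* (ε :* C⁻¹) :* w
        := ε :* ((:1 :+ (M :+ M) :* w) :* C⁻¹) :- ε :* C⁻¹) refl M w ε (reciprocal C 0<C) ⟩
      ε * (C * reciprocal C 0<C) - δ ε   ≈⟨ +-congʳ (*-congˡ (*-reciprocal C 0<C)) ⟩
      ε * 1# - δ ε                       ≈⟨ +-congʳ (*-identityʳ ε) ⟩
      ε - δ ε                            ∎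
      where open ≈-Reasoning setoid

    -- Linearizing at the tag `t` towards `y` and towards `x` and subtracting eliminates `G t`. Both
    -- errors are at most M e² for the cell length `e`, and one factor `e` is then replaced by
    -- `δ ε`.
    local : ∀ ε d (x t y : Segment D u v) →
      proj₁ x ≤[ d ] proj₁ t → proj₁ t ≤[ d ] proj₁ y → Close (δ ε) (proj₁ y) (proj₁ x) →
      ∣ G y - G x - g t * (proj₁ y - proj₁ x) ∣≤
        (M + M) * δ ε * (signed d (proj₁ y) - signed d (proj₁ x))
    local ε d x@(x′ , _) t@(t′ , _) y@(y′ , _) x≤t t≤y y-x<δ =
      ∣∣≤-mono (0≤⇒≤ (0≤x*y 0≤M+M (0≤x*y (0≤signed d (≤[]-trans d x≤t t≤y)) (x≤y⇒0≤y-x (Close⇒signed≤ d y-x<δ))))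
        (solve 3 (λ M e δ → (M :+ M) :* (e :* (δ :- e)) := (M :+ M) :* δ :* e :- (M :* (e :* e) :+ M :* (e :* e)))
          refl M e (δ ε)))
      (∣∣≤-cong (solve 7 (λ X T Y g x t y →
          (Y :- T :- g :* (y :- t)) :+ :- (X :- T :- g :* (x :- t)) := Y :- X :- g :* (y :- x))
          refl (G x) (G t) (G y) (g t) x′ t′ y′)
        (∣∣≤-+ (linearizable t y ∣y-t∣≤e) (∣∣≤-neg (linearizable t x ∣x-t∣≤e))))
      where
      open HasDerivative DG
      e = signed d y′ - signed d x′
      ∣y-t∣≤e : ∣ y′ - t′ ∣≤ e
      ∣y-t∣≤e = ∣∣≤-mono (0≤⇒≤ (0≤signed d x≤t)
        (solve 3 (λ x t y → t :- x := y :- x :- (y :- t)) refl (signed d x′) (signed d t′) (signed d y′)))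
        (∣∣≤signed d t≤y)
      ∣x-t∣≤e : ∣ x′ - t′ ∣≤ e
      ∣x-t∣≤e = ∣∣≤-mono (0≤⇒≤ (0≤signed d t≤y)
        (solve 3 (λ x t y → y :- t := y :- x :- (t :- x)) refl (signed d x′) (signed d t′) (signed d y′)))
        (∣∣≤-cong (solve 2 (λ x t → :- (t :- x) := x :- t) refl x′ t′) (∣∣≤-neg (∣∣≤signed d x≤t)))

    module _ (P : TaggedPartition u v) where
      open TaggedPartition P

      close : ∀ ε → 0# < ε → (tag∈D : ∀ i → D (tag i)) → FinerThan (δ ε) →
              Close ε (riemannSum f tag∈D) (G (segment-end D u v Dv) - G (segment-start D u v Du))
      close ε 0<ε tag∈D fine = ∣∣≤⇒Close (0<δ ε 0<ε) (∣∣≤-respʳ (δ-total ε) error)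
        where
        d = proj₁ (direction P)
        ordered-by = proj₂ (direction P)
        κ = (M + M) * δ ε

        inside : ∀ {t} → point zero ≤[ d ] t → t ≤[ d ] point (fromℕ size) → Between u v t
        inside start≤t t≤end = between d (≤[]-trans d (≤[]-reflexive (sym start)) start≤t) (≤[]-respʳ-≈ d end t≤end)
          where
          ≤[]-reflexive : ∀ {x y} → x ≈ y → x ≤[ d ] y
          ≤[]-reflexive x≈y = ≤[]-respʳ-≈ d x≈y (≤[]-refl d)

        steps : ∀ i → point (inject₁ i) ≤[ d ] point (suc i)
        steps i = ≤[]-trans d (proj₁ (ordered-by i)) (proj₂ (ordered-by i))

        point∈ : ∀ j → Between u v (point j)
        point∈ j = let left , right = monotone d point steps j in inside left right

        node : Fin (suc size) → Segment D u v
        node j = point j , segment⊆D (point j) (point∈ j) , λ k → k (point∈ j)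

        tag∈ : ∀ i → Between u v (tag i)
        tag∈ i = inside (≤[]-trans d (proj₁ (monotone d point steps (inject₁ i))) (proj₁ (ordered-by i)))
                        (≤[]-trans d (proj₂ (ordered-by i)) (proj₂ (monotone d point steps (suc i))))

        tag-node : Fin size → Segment D u v
        tag-node i = tag i , tag∈D i , λ k → k (tag∈ i)

        ∣end-start∣≤w : ∣ point (fromℕ size) - point zero ∣≤ w
        ∣end-start∣≤w = ∣∣≤-cong (+-cong (sym end) (-‿cong (sym start))) ∣v-u∣≤w

        summed : ∣ G (node (fromℕ size)) - G (node zero) - riemannSum f tag∈D ∣≤
                 κ * (signed d (point (fromℕ size)) - signed d (point zero))
        summed = telescope (λ j → G (node j)) (λ j → signed d (point j))
          (λ i → f (tag i) (tag∈D i) * (point (suc i) - point (inject₁ i))) κ λ i →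
          ∣∣≤-cong (+-congˡ (-‿cong (*-congʳ (sym (f≈g (tag i) (tag∈D i) (proj₂ (proj₂ (tag-node i))))))))
            (local ε d (node (inject₁ i)) (tag-node i) (node (suc i))
              (proj₁ (ordered-by i)) (proj₂ (ordered-by i)) (fine i))

        κ*length≤κ*w : κ * (signed d (point (fromℕ size)) - signed d (point zero)) ≤ κ * w
        κ*length≤κ*w = 0≤⇒≤
          (0≤x*y (0≤x*y 0≤M+M (<⇒≤ (0<δ ε 0<ε))) (x≤y⇒0≤y-x (signed≤ d ∣end-start∣≤w)))
          (solve 3 (λ κ s w → κ :* (w :- s) := κ :* w :- κ :* s)
            refl κ (signed d (point (fromℕ size)) - signed d (point zero)) w)

        error : ∣ G (segment-end D u v Dv) - G (segment-start D u v Du) - riemannSum f tag∈D ∣≤ κ * w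
        error = ∣∣≤-mono κ*length≤κ*w
          (∣∣≤-cong (+-congʳ (+-cong
            (extensional proj₁ DG (node (fromℕ size)) (segment-end D u v Dv) end)
            (-‿cong (extensional proj₁ DG (node zero) (segment-start D u v Du) start)))) summed)

-- Existence of fine partitions and uniqueness of the integral

module Chains {c ℓ₁ ℓ₂} (ℝ : RealField c ℓ₁ ℓ₂) where
  open RealField ℝ hiding (zero)
  open Analysis ℝ
  open OrderedField ℝ
  open FundamentalTheorem ℝ using (between)
  open IsStrictPartialOrder isStrictPartialOrder using (<-respʳ-≈; <-respˡ-≈)
    renaming (trans to <-trans)
  open IntegerRingSolver commutativeRing

  Close-mono : ∀ {ε δ x y} → ε ≤ δ → Close ε x y → Close δ x y
  Close-mono ε≤δ (p , q) = <-≤-trans p ε≤δ , <-≤-trans q ε≤δ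

  -- Stands in for the minimum of two moduli when the goal is `⊥`.
  smaller : ∀ δ δ′ → 0# < δ → 0# < δ′ →
    ((η : Carrier) → 0# < η → η ≤ δ → η ≤ δ′ → ⊥) → ⊥
  smaller δ δ′ 0<δ 0<δ′ k = ¬¬≤-total δ δ′
    (λ δ≤δ′ → k δ 0<δ ≤-refl δ≤δ′) (λ δ′≤δ → k δ′ 0<δ′ δ′≤δ ≤-refl)

  -- Partitions tagged at the starting points of their cells.
  module _ {p} (D : Carrier → Set p) (d : Direction) (δ : Carrier) where

    data Chain : Carrier → Carrier → Set (c ⊔ ℓ₂ ⊔ p) where
      []  : ∀ {u} → Chain u u
      step : ∀ {u w v} → D u → u ≤[ d ] w → Close δ w u → Chain w v → Chain u v

  module _ {p} {D : Carrier → Set p} {d : Direction} {δ : Carrier} where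

    infixr 5 _++_
    _++_ : ∀ {u w v} → Chain D d δ u w → Chain D d δ w v → Chain D d δ u v
    []              ++ c′ = c′
    step Du u≤w h c ++ c′ = step Du u≤w h (c ++ c′)

    chain⇒≤ : ∀ {u v} → Chain D d δ u v → u ≤[ d ] v
    chain⇒≤ []               = ≤[]-refl d
    chain⇒≤ (step _ u≤w _ c) = ≤[]-trans d u≤w (chain⇒≤ c)

    private
      length : ∀ {u v} → Chain D d δ u v → ℕ
      length []             = 0
      length (step _ _ _ c) = suc (length c)

      node : ∀ {u v} (c : Chain D d δ u v) → Fin (suc (length c)) → Carrier
      node {u} c              zero    = u
      node     (step _ _ _ c) (suc i) = node c i

      node-end : ∀ {u v} (c : Chain D d δ u v) → node c (fromℕ (length c)) ≈ v
      node-end []             = refl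
      node-end (step _ _ _ c) = node-end c

      node∈D : ∀ {u v} (c : Chain D d δ u v) i → D (node c (inject₁ i))
      node∈D (step Du _ _ c) zero    = Du
      node∈D (step _ _ _ c)  (suc i) = node∈D c i

      node-≤ : ∀ {u v} (c : Chain D d δ u v) i → node c (inject₁ i) ≤[ d ] node c (suc i)
      node-≤ (step _ u≤w _ c) zero    = u≤w
      node-≤ (step _ _ _ c)   (suc i) = node-≤ c i

      node-close : ∀ {u v} (c : Chain D d δ u v) i → Close δ (node c (suc i)) (node c (inject₁ i))
      node-close (step _ _ h c) zero    = h
      node-close (step _ _ _ c) (suc i) = node-close c i

      tags-ordered : ∀ {n} d (x : Fin (suc n) → Carrier) →
        (∀ i → x (inject₁ i) ≤[ d ] x (suc i)) →
        (∀ i → x (inject₁ i) ≤ x (inject₁ i) × x (inject₁ i) ≤ x (suc i)) ⊎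
        (∀ i → x (suc i) ≤ x (inject₁ i) × x (inject₁ i) ≤ x (inject₁ i))
      tags-ordered up   x h = inj₁ λ i → ≤-refl , h i
      tags-ordered down x h = inj₂ λ i → h i , ≤-refl

    partition : ∀ {u v} → Chain D d δ u v → TaggedPartition u v
    partition c = record
      { size    = length c
      ; point   = node c
      ; tag     = λ i → node c (inject₁ i)
      ; start   = refl
      ; end     = node-end c
      ; ordered = tags-ordered d (node c) (node-≤ c)
      }

    riemann : PartialFunction D → ∀ {u v} → Chain D d δ u v → Carrier
    riemann f c = TaggedPartition.riemannSum (partition c) f (node∈D c)

    riemann-++ : ∀ f {u w v} (c : Chain D d δ u w) (c′ : Chain D d δ w v) →
      riemann f (c ++ c′) ≈ riemann f c + riemann f c′
    riemann-++ f []              c′ = sym (+-identityˡ (riemann f c′))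
    riemann-++ f (step Du _ _ c) c′ = trans (+-congˡ (riemann-++ f c c′)) (sym (+-assoc _ _ _))

    riemann-close : ∀ f {u v I} (∫f : IsIntegral f u v I) ε 0<ε → δ ≤ proj₁ (proj₂ ∫f ε 0<ε) →
      (c : Chain D d δ u v) → Close ε (riemann f c) I
    riemann-close f (_ , approx) ε 0<ε δ≤η c =
      proj₂ (proj₂ (approx ε 0<ε)) (partition c) (node∈D c) (λ i → Close-mono δ≤η (node-close c i))

    private
      ≤n·h : ∀ {h} → (∀ x → x ≤[ d ] x + h) → ∀ n x → x ≤[ d ] x + n · h
      ≤n·h     x≤x+h zero    x = ≤[]-respʳ-≈ d (sym (+-identityʳ x)) (≤[]-refl d)
      ≤n·h {h} x≤x+h (suc n) x = ≤[]-trans d (x≤x+h x) (≤[]-respʳ-≈ d (+-assoc x h (n · h)) (≤n·h x≤x+h n (x + h)))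

    uniform-chain : ∀ h → (∀ x → x ≤[ d ] x + h) → (∀ x → Close δ (x + h) x) →
      ∀ n u v → u + suc n · h ≈ v → (∀ t → u ≤[ d ] t → t ≤[ d ] v → D t) → Chain D d δ u v
    -- The last cell is drawn to `v` itself, since `[]` requires identical endpoints while `u + h`
    -- is only `≈` to `v`. This is why the number of cells is `suc n`.
    uniform-chain h x≤x+h close zero u v u+h≈v D-convex =
      step (D-convex u (≤[]-refl d) (≤[]-respʳ-≈ d u+h≈v′ (x≤x+h u))) (≤[]-respʳ-≈ d u+h≈v′ (x≤x+h u))
        (<-respˡ-≈ (+-congʳ u+h≈v′) (proj₁ (close u)) , <-respˡ-≈ (+-congˡ (-‿cong u+h≈v′)) (proj₂ (close u)))
        []
      where
      u+h≈v′ : u + h ≈ v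
      u+h≈v′ = trans (+-congˡ (sym (+-identityʳ h))) u+h≈v
    uniform-chain h x≤x+h close (suc n) u v u+nh≈v D-convex =
      step (D-convex u (≤[]-refl d) (≤[]-respʳ-≈ d u+nh≈v (≤n·h x≤x+h (suc (suc n)) u))) (x≤x+h u) (close u)
        (uniform-chain h x≤x+h close n (u + h) v (trans (+-assoc u h _) u+nh≈v)
          (λ t u+h≤t t≤v → D-convex t (≤[]-trans d (x≤x+h u) u+h≤t) t≤v))

  n·x≈n·1*x : ∀ n x → n · x ≈ (n · 1#) * x
  n·x≈n·1*x zero    x = sym (zeroˡ x)
  n·x≈n·1*x (suc n) x = trans (+-congˡ (n·x≈n·1*x n x))
    (solve 2 (λ x n → x :+ n :* x := (:1 :+ n) :* x) refl x (n · 1#))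

  -- A step of length z / (n + 1) is shorter than δ once n > z / δ.
  subdivision : ∀ δ → 0# < δ → ∀ z → 0# ≤ z →
    ∃[ n ] Σ[ h ∈ Carrier ] (suc n · h ≈ z × 0# ≤ h × h < δ)
  subdivision δ 0<δ z 0≤z with archimedean (z * reciprocal δ 0<δ)
  ... | n , z/δ<n = n , h , trans (n·x≈n·1*x (suc n) h) n+1*h≈z , 0≤x*y 0≤z (<⇒≤ 0<r) , h<δ
    where
    N = suc n · 1#
    0<N = 0<n (suc n)
    r = reciprocal N 0<N
    0<r = 0<reciprocal N 0<N
    h = z * r

    n+1*h≈z : N * h ≈ z
    n+1*h≈z = trans (solve 3 (λ N z r → N :* (z :* r) := z :* (N :* r)) refl N z r)
      (trans (*-congˡ (*-reciprocal N 0<N)) (*-identityʳ z))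

    n<N : n · 1# < N
    n<N = <-respˡ-≈ (+-identityˡ (n · 1#)) (+-monoˡ-< (n · 1#) 0<1)

    h<δ : h < δ
    h<δ = <-respʳ-≈ rhs (<-respˡ-≈ lhs (*-monoˡ-<-pos (*-pos 0<δ 0<r) (<-trans z/δ<n n<N)))
      where
      lhs : z * reciprocal δ 0<δ * (δ * r) ≈ h
      lhs = trans (solve 4 (λ z d d⁻¹ r → z :* d⁻¹ :* (d :* r) := (d :* d⁻¹) :* (z :* r)) refl z δ (reciprocal δ 0<δ) r)
        (trans (*-congʳ (*-reciprocal δ 0<δ)) (*-identityˡ h))
      rhs : N * (δ * r) ≈ δ
      rhs = trans (solve 3 (λ N d r → N :* (d :* r) := (N :* r) :* d) refl N δ r)
        (trans (*-congʳ (*-reciprocal N 0<N)) (*-identityˡ δ))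

  chain : ∀ {p} {D : Carrier → Set p} d {u v} → u ≤[ d ] v → ∀ δ → 0# < δ →
    (∀ t → u ≤[ d ] t → t ≤[ d ] v → D t) → Chain D d δ u v
  chain up {u} {v} u≤v δ 0<δ D-convex =
    let n , h , n·h≈v-u , 0≤h , h<δ = subdivision δ 0<δ (v - u) (x≤y⇒0≤y-x u≤v)
    in uniform-chain h
      (λ x → 0≤⇒≤ 0≤h (solve 2 (λ x h → h := x :+ h :- x) refl x h))
      (λ x → <-respˡ-≈ (solve 2 (λ x h → h := x :+ h :- x) refl x h) h<δ ,
             ≤-<-trans (0≤⇒≤ 0≤h (solve 2 (λ x h → h := :0 :- (x :- (x :+ h))) refl x h)) 0<δ)
      n u v (trans (+-congˡ n·h≈v-u) (solve 2 (λ u v → u :+ (v :- u) := v) refl u v)) D-convex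
  chain down {u} {v} v≤u δ 0<δ D-convex =
    let n , h , n·h≈u-v , 0≤h , h<δ = subdivision δ 0<δ (u - v) (x≤y⇒0≤y-x v≤u)
    in uniform-chain (- h)
      (λ x → 0≤⇒≤ 0≤h (solve 2 (λ x h → h := x :- (x :- h)) refl x h))
      (λ x → ≤-<-trans (0≤⇒≤ 0≤h (solve 2 (λ x h → h := :0 :- (x :- h :- x)) refl x h)) 0<δ ,
             <-respˡ-≈ (solve 2 (λ x h → h := x :- (x :- h)) refl x h) h<δ)
      n u v (trans (+-congˡ (trans (n·x≈n·1*x (suc n) (- h))
          (solve 2 (λ N h → N :* :- h := :- (N :* h)) refl (suc n · 1#) h)))
        (trans (+-congˡ (-‿cong (trans (sym (n·x≈n·1*x (suc n) h)) n·h≈u-v)))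
          (solve 2 (λ u v → u :- (u :- v) := v) refl u v))) D-convex

  module _ {p} {D : Carrier → Set p} (f : PartialFunction D) {u v : Carrier} where

    private
      -- A Riemann sum fine enough for both moduli lies within ε of `I` and of `J`. The direction of
      -- the segment and the common modulus are found only under a double negation, which `≤-limit`
      -- permits.
      integral-≤ : ∀ {I J} → IsIntegral f u v I → IsIntegral f u v J → I ≤ J
      integral-≤ {I} {J} ∫I ∫J = ≤-limit λ ε 0<ε k → ¬¬≤[]-total u v λ d u≤v →
        let η , 0<η , toI = proj₂ ∫I ε 0<ε
            θ , 0<θ , toJ = proj₂ ∫J ε 0<ε
        in smaller η θ 0<η 0<θ λ δ 0<δ δ≤η δ≤θ →
          let c = chain d u≤v δ 0<δ (λ t u≤t t≤v → proj₁ ∫I t (between d u≤t t≤v))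
              S = riemann f c
              _ , I-S<ε = riemann-close f ∫I ε 0<ε δ≤η c
              S-J<ε , _ = riemann-close f ∫J ε 0<ε δ≤θ c
          in k (<-trans (0<⇒< (x<y⇒0<y-x I-S<ε)
                 (solve 4 (λ I J S ε → ε :- (I :- S) := ε :+ (S :- J) :- (I :- J)) refl I J S ε))
               (0<⇒< (x<y⇒0<y-x S-J<ε)
                 (solve 3 (λ J S ε → ε :- (S :- J) := ε :+ ε :- (ε :+ (S :- J))) refl J S ε)))

    integral-unique : ∀ {I J} → IsIntegral f u v I → IsIntegral f u v J → I ≈ J
    integral-unique ∫I ∫J = ≤-antisym (integral-≤ ∫I ∫J) (integral-≤ ∫J ∫I)

    integral-cong : ∀ {I J} → I ≈ J → IsIntegral f u v I → IsIntegral f u v J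
    integral-cong I≈J (f-defined , approx) = f-defined , λ ε 0<ε →
      let δ , 0<δ , close = approx ε 0<ε
      in δ , 0<δ , λ P tag∈D fine →
        let S-I<ε , I-S<ε = close P tag∈D fine
        in <-respˡ-≈ (+-congˡ (-‿cong I≈J)) S-I<ε , <-respˡ-≈ (+-congʳ I≈J) I-S<ε

-- The tangent inequality and the derivative of the logarithm

module Logarithm {c ℓ₁ ℓ₂} (ℝ : RealField c ℓ₁ ℓ₂) where
  open RealField ℝ hiding (zero)
  open Analysis ℝ
  open OrderedField ℝ
  open Differentiation ℝ
  open Chains ℝ
  open IsStrictPartialOrder isStrictPartialOrder using (<-respˡ-≈)
  open IntegerRingSolver commutativeRing

  positive-convex : ∀ d {u v t} → 0# < u → 0# < v → u ≤[ d ] t → t ≤[ d ] v → 0# < t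
  positive-convex up   0<u 0<v u≤t t≤v = <-≤-trans 0<u u≤t
  positive-convex down 0<u 0<v t≤u v≤t = <-≤-trans 0<v v≤t

  module _ {d : Direction} {δ : Carrier} where

    -- Splitting off the first cell, from u to w, leaves the surplus (w - u)(v - w)/(u w). Both
    -- increments point in direction `d`, so it is nonnegative for descending chains too.
    riemann-reciprocal-≤ : ∀ {u v} 0<u → 0# < v → (c : Chain Positive d δ u v) →
      riemann reciprocal c ≤ (v - u) * reciprocal u 0<u
    riemann-reciprocal-≤ {u} 0<u 0<v [] =
      ≤-reflexive (solve 2 (λ u r → :0 := (u :- u) :* r) refl u (reciprocal u 0<u))
    riemann-reciprocal-≤ {u} {v} 0<u 0<v (step {w = w} 0<u′ u≤w _ c) = 0≤⇒≤
      (0≤x+y (x≤y⇒0≤y-x (riemann-reciprocal-≤ 0<w 0<v c))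
        (0≤x*y (0≤product d u≤w (chain⇒≤ c)) (<⇒≤ (*-pos (0<reciprocal u 0<u) (0<reciprocal w 0<w)))))
      (begin
        (v - w) * w⁻¹ - S + (w - u) * (v - w) * (u⁻¹ * w⁻¹)   ≈⟨ solve 6 (λ u v w u⁻¹ w⁻¹ S →
          (v :- w) :* w⁻¹ :- S :+ (w :- u) :* (v :- w) :* (u⁻¹ :* w⁻¹)
          := (v :- w) :* ((w :- u) :* (u⁻¹ :* w⁻¹)) :+ ((v :- w) :* w⁻¹ :- S)) refl u v w u⁻¹ w⁻¹ S ⟩
        (v - w) * ((w - u) * (u⁻¹ * w⁻¹)) + ((v - w) * w⁻¹ - S) ≈⟨ +-congʳ (*-congˡ (reciprocal-difference u 0<u w 0<w)) ⟨
        (v - w) * (u⁻¹ - w⁻¹) + ((v - w) * w⁻¹ - S)           ≈⟨ solve 6 (λ u v w u⁻¹ w⁻¹ S →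
          (v :- w) :* (u⁻¹ :- w⁻¹) :+ ((v :- w) :* w⁻¹ :- S)
          := (v :- u) :* u⁻¹ :- (u⁻¹ :* (w :- u) :+ S)) refl u v w u⁻¹ w⁻¹ S ⟩
        (v - u) * u⁻¹ - (u⁻¹ * (w - u) + S)                   ≈⟨ +-congˡ (-‿cong (+-congʳ (*-congʳ (reciprocal-cong 0<u 0<u′ refl)))) ⟩
        (v - u) * u⁻¹ - (reciprocal u 0<u′ * (w - u) + S)     ∎)
      where
      open ≈-Reasoning setoid
      0<w = positive-convex d 0<u 0<v u≤w (chain⇒≤ c)
      u⁻¹ = reciprocal u 0<u
      w⁻¹ = reciprocal w 0<w
      S = riemann reciprocal c

    -- Here the first cell contributes 1/u per unit length where the bound claims 1/v; the surplus
    -- is (w - u)(v - u)/(u v).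
    ≤-riemann-reciprocal : ∀ {u v} → 0# < u → ∀ 0<v → (c : Chain Positive d δ u v) →
      (v - u) * reciprocal v 0<v ≤ riemann reciprocal c
    ≤-riemann-reciprocal {u} 0<u 0<v [] =
      ≤-reflexive (solve 2 (λ u r → (u :- u) :* r := :0) refl u (reciprocal u 0<v))
    ≤-riemann-reciprocal {u} {v} 0<u 0<v (step {w = w} 0<u′ u≤w _ c) = 0≤⇒≤
      (0≤x+y (x≤y⇒0≤y-x (≤-riemann-reciprocal 0<w 0<v c))
        (0≤x*y (0≤product d u≤w (≤[]-trans d u≤w (chain⇒≤ c)))
          (<⇒≤ (*-pos (0<reciprocal u 0<u′) (0<reciprocal v 0<v)))))
      (begin
        S - (v - w) * v⁻¹ + (w - u) * (v - u) * (u⁻¹ * v⁻¹)   ≈⟨ solve 6 (λ u v w u⁻¹ v⁻¹ S →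
          S :- (v :- w) :* v⁻¹ :+ (w :- u) :* (v :- u) :* (u⁻¹ :* v⁻¹)
          := (w :- u) :* ((v :- u) :* (u⁻¹ :* v⁻¹)) :+ (S :- (v :- w) :* v⁻¹)) refl u v w u⁻¹ v⁻¹ S ⟩
        (w - u) * ((v - u) * (u⁻¹ * v⁻¹)) + (S - (v - w) * v⁻¹) ≈⟨ +-congʳ (*-congˡ (reciprocal-difference u 0<u′ v 0<v)) ⟨
        (w - u) * (u⁻¹ - v⁻¹) + (S - (v - w) * v⁻¹)           ≈⟨ solve 6 (λ u v w u⁻¹ v⁻¹ S →
          (w :- u) :* (u⁻¹ :- v⁻¹) :+ (S :- (v :- w) :* v⁻¹)
          := u⁻¹ :* (w :- u) :+ S :- (v :- u) :* v⁻¹) refl u v w u⁻¹ v⁻¹ S ⟩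
        u⁻¹ * (w - u) + S - (v - u) * v⁻¹                     ∎)
      where
      open ≈-Reasoning setoid
      0<w = positive-convex d 0<u 0<v u≤w (chain⇒≤ c)
      u⁻¹ = reciprocal u 0<u′
      v⁻¹ = reciprocal v 0<v
      S = riemann reciprocal c

  module _ (ln : PartialFunction Positive) (isLn : IsLn ln) where

    private
      -- A chain from 1 to `u` is prolonged by one from `u` to `v`. Subtracting the Riemann sum of
      -- the initial piece from that of the whole leaves the sum over the second piece, at the cost
      -- of two errors ε.
      increment-approx : ∀ d {u v} 0<u 0<v → 1# ≤[ d ] u → u ≤[ d ] v → ∀ ε → 0# < ε →
        (∀ S → (v - u) * reciprocal v 0<v ≤ S → S ≤ (v - u) * reciprocal u 0<u →
          Close (ε + ε) (ln v 0<v - ln u 0<u) S → ⊥) → ⊥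
      increment-approx d {u} {v} 0<u 0<v 1≤u u≤v ε 0<ε k =
        smaller (proj₁ (proj₂ ∫u ε 0<ε)) (proj₁ (proj₂ ∫v ε 0<ε))
          (proj₁ (proj₂ (proj₂ ∫u ε 0<ε))) (proj₁ (proj₂ (proj₂ ∫v ε 0<ε)))
        λ δ 0<δ δ≤η δ≤θ →
        let c  = chain d 1≤u δ 0<δ (λ t → positive-convex d 0<1 0<u)
            c′ = chain d u≤v δ 0<δ (λ t → positive-convex d 0<u 0<v)
            S  = riemann reciprocal c
            S′ = riemann reciprocal c′
            S+S′≈ = riemann-++ reciprocal c c′
            S-lnu<ε , lnu-S<ε = riemann-close reciprocal ∫u ε 0<ε δ≤η c
            S″-lnv<ε , lnv-S″<ε = riemann-close reciprocal ∫v ε 0<ε δ≤θ (c ++ c′)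
        in k S′ (≤-riemann-reciprocal 0<u 0<v c′) (riemann-reciprocal-≤ 0<u 0<v c′)
          ( 0<⇒< (0<x+y (x<y⇒0<y-x S-lnu<ε)
                (<⇒≤ (x<y⇒0<y-x (<-respˡ-≈ (+-congˡ (-‿cong S+S′≈)) lnv-S″<ε))))
              (solve 5 (λ l m S S′ ε → (ε :- (S :- l)) :+ (ε :- (m :- (S :+ S′))) := ε :+ ε :- (m :- l :- S′))
                refl (ln u 0<u) (ln v 0<v) S S′ ε)
          , 0<⇒< (0<x+y (x<y⇒0<y-x lnu-S<ε)
                (<⇒≤ (x<y⇒0<y-x (<-respˡ-≈ (+-congʳ S+S′≈) S″-lnv<ε))))
              (solve 5 (λ l m S S′ ε → (ε :- (l :- S)) :+ (ε :- (S :+ S′ :- m)) := ε :+ ε :- (S′ :- (m :- l)))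
                refl (ln u 0<u) (ln v 0<v) S S′ ε))
        where
        ∫u = isLn u 0<u
        ∫v = isLn v 0<v

      same-side-≤ : ∀ d {u v} 0<u 0<v → 1# ≤[ d ] u → u ≤[ d ] v →
        ln v 0<v - ln u 0<u ≤ (v - u) * reciprocal u 0<u
      same-side-≤ d {u} {v} 0<u 0<v 1≤u u≤v = ≤-limit λ ε 0<ε k →
        increment-approx d 0<u 0<v 1≤u u≤v ε 0<ε λ S _ S≤U (Δ-S<2ε , _) →
        k (≤-<-trans (0≤⇒≤ (x≤y⇒0≤y-x S≤U)
            (solve 3 (λ Δ S U → U :- S := Δ :- S :- (Δ :- U)) refl (ln v 0<v - ln u 0<u) S ((v - u) * reciprocal u 0<u)))
          Δ-S<2ε)

      -- The tangent inequality based at the point farther from 1, obtained from the lower bound for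
      -- the Riemann sum.
      same-side-≥ : ∀ d {u v} 0<u 0<v → 1# ≤[ d ] u → u ≤[ d ] v →
        ln u 0<u - ln v 0<v ≤ (u - v) * reciprocal v 0<v
      same-side-≥ d {u} {v} 0<u 0<v 1≤u u≤v = ≤-limit λ ε 0<ε k →
        increment-approx d 0<u 0<v 1≤u u≤v ε 0<ε λ S L≤S _ (_ , S-Δ<2ε) →
        k (≤-<-trans (0≤⇒≤ (x≤y⇒0≤y-x L≤S)
            (solve 6 (λ l m S u v v⁻¹ → S :- (v :- u) :* v⁻¹ := S :- (m :- l) :- (l :- m :- (u :- v) :* v⁻¹))
              refl (ln u 0<u) (ln v 0<v) S u v (reciprocal v 0<v)))
          S-Δ<2ε)

      -- The inequalities for ln v - ln 1 and ln 1 - ln u are added. Their bounds v - 1 and (1 -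
      -- u)/u fall short of (v - u)/u by (v - 1)(1 - u)/u, which is nonnegative because 1 lies
      -- between u and v. The value of ln 1 cancels.
      opposite-sides : ∀ d d′ {u v} 0<u 0<v → 1# ≤[ d ] u → 1# ≤[ d′ ] v → u ≤[ d′ ] 1# →
        ln v 0<v - ln u 0<u ≤ (v - u) * reciprocal u 0<u
      opposite-sides d d′ {u} {v} 0<u 0<v 1≤u 1≤v u≤1 = 0≤⇒≤
        (0≤x+y (0≤x+y (x≤y⇒0≤y-x (same-side-≤ d′ 0<1 0<v (≤[]-refl d′) 1≤v))
                      (x≤y⇒0≤y-x (same-side-≥ d 0<1 0<u (≤[]-refl d) 1≤u)))
               (0≤x*y (0≤product d′ 1≤v u≤1) (<⇒≤ (0<reciprocal u 0<u))))
        (begin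
          ((v - 1#) * 1⁻¹ - (m - o)) + ((1# - u) * u⁻¹ - (o - l)) + (v - 1#) * (1# - u) * u⁻¹
            ≈⟨ +-congʳ (+-congʳ (+-congʳ (*-congˡ 1⁻¹≈u*u⁻¹))) ⟩
          ((v - 1#) * (u * u⁻¹) - (m - o)) + ((1# - u) * u⁻¹ - (o - l)) + (v - 1#) * (1# - u) * u⁻¹
            ≈⟨ solve 6 (λ u v u⁻¹ l m o →
              ((v :- :1) :* (u :* u⁻¹) :- (m :- o)) :+ ((:1 :- u) :* u⁻¹ :- (o :- l)) :+ (v :- :1) :* (:1 :- u) :* u⁻¹
              := (v :- u) :* u⁻¹ :- (m :- l)) refl u v u⁻¹ l m o ⟩
          (v - u) * u⁻¹ - (m - l) ∎)
        where
        open ≈-Reasoning setoid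
        1⁻¹ = reciprocal 1# 0<1
        u⁻¹ = reciprocal u 0<u
        l = ln u 0<u
        m = ln v 0<v
        o = ln 1# 0<1
        1⁻¹≈u*u⁻¹ : 1⁻¹ ≈ u * u⁻¹
        1⁻¹≈u*u⁻¹ = trans (sym (*-identityˡ 1⁻¹)) (trans (*-reciprocal 1# 0<1) (sym (*-reciprocal u 0<u)))

      by-sides : ∀ d d′ {u v} 0<u 0<v → 1# ≤[ d ] u → 1# ≤[ d′ ] v →
        ¬ ¬ (ln v 0<v - ln u 0<u ≤ (v - u) * reciprocal u 0<u)
      by-sides up up {u} {v} 0<u 0<v 1≤u 1≤v k = ¬¬≤-total u v
        (λ u≤v → k (same-side-≤ up 0<u 0<v 1≤u u≤v)) (λ v≤u → k (same-side-≥ up 0<v 0<u 1≤v v≤u))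
      by-sides down down {u} {v} 0<u 0<v u≤1 v≤1 k = ¬¬≤-total u v
        (λ u≤v → k (same-side-≥ down 0<v 0<u v≤1 u≤v)) (λ v≤u → k (same-side-≤ down 0<u 0<v u≤1 v≤u))
      by-sides up down 0<u 0<v 1≤u v≤1 k = k (opposite-sides up down 0<u 0<v 1≤u v≤1 1≤u)
      by-sides down up 0<u 0<v u≤1 1≤v k = k (opposite-sides down up 0<u 0<v u≤1 1≤v u≤1)

    -- Concavity of the logarithm. Exchanging `u` and `v` yields the matching lower bound, so this
    -- single inequality supports every later estimate of `ln`.
    ln-tangent : ∀ u v 0<u 0<v → ln v 0<v - ln u 0<u ≤ (v - u) * reciprocal u 0<u
    ln-tangent u v 0<u 0<v tangent< = ¬¬≤[]-total 1# u λ d 1≤u → ¬¬≤[]-total 1# v λ d′ 1≤v →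
      by-sides d d′ 0<u 0<v 1≤u 1≤v λ tangent → tangent tangent<

    -- The tangent inequality with zero increment; it also gives independence of the positivity
    -- proof.
    ln-cong : ∀ {u v} 0<u 0<v → u ≈ v → ln u 0<u ≈ ln v 0<v
    ln-cong {u} {v} 0<u 0<v u≈v = ≤-antisym (half 0<v 0<u (sym u≈v)) (half 0<u 0<v u≈v)
      where
      half : ∀ {u v} 0<u 0<v → u ≈ v → ln v 0<v ≤ ln u 0<u
      half {u} {v} 0<u 0<v u≈v = 0≤⇒≤ (x≤y⇒0≤y-x (ln-tangent u v 0<u 0<v))
        (trans (+-congʳ (*-congʳ (+-congˡ (-‿cong u≈v))))
          (solve 4 (λ v r l m → (v :- v) :* r :- (m :- l) := l :- m) refl v (reciprocal u 0<u) (ln u 0<u) (ln v 0<v)))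

    -- The tangent inequality at either end gives the Lipschitz constant `r`, a bound on the
    -- reciprocals. The bound on `ln` itself is the Lipschitz estimate from the reference point `o`.
    ln-hasDerivative : ∀ {p} {X : Set p} (ι : X → Carrier) (a : Carrier) (pos : ∀ u → 0# < ι u + a) {r w : Carrier} →
      (∀ u → ∣ reciprocal (ι u + a) (pos u) ∣≤ r) → ∀ o → (∀ u → ∣ ι u - ι o ∣≤ w) →
      HasDerivative ι (λ u → ln (ι u + a) (pos u)) (λ u → reciprocal (ι u + a) (pos u))
    ln-hasDerivative ι a pos {r} {w} ∣s⁻¹∣≤r o ∣ι-o∣≤w = record
      { bound        = r * w + (1# + l o * l o)
      ; lipschitz    = r
      ; curvature    = r * r
      ; bounded      = λ u → ∣∣≤-cong (solve 2 (λ x y → x :- y :+ y := x) refl (l u) (l o))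
                         (∣∣≤-+ (lip o u (∣ι-o∣≤w u)) (∣x∣≤1+x² (l o)))
      ; isLipschitz  = λ u v → lip u v
      ; linearizable = quad
      }
      where
      l s⁻¹ : _ → Carrier
      l u = ln (ι u + a) (pos u)
      s⁻¹ u = reciprocal (ι u + a) (pos u)

      l-tangent : ∀ u v → 0# ≤ (ι v - ι u) * s⁻¹ u - (l v - l u)
      l-tangent u v = ≤-respʳ-≈
        (+-congʳ (*-congʳ (solve 3 (λ a x y → y :+ a :- (x :+ a) := y :- x) refl a (ι u) (ι v))))
        (x≤y⇒0≤y-x (ln-tangent (ι u + a) (ι v + a) (pos u) (pos v)))

      lip : ∀ u v {e} → ∣ ι v - ι u ∣≤ e → ∣ l v - l u ∣≤ r * e
      lip u v {e} d =
        ≤-respʳ-≈ (solve 6 (λ r e x r′ l m → (r :* e :- r′ :* x) :+ (x :* r′ :- (m :- l)) := r :* e :- (m :- l))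
            refl r e (ι v - ι u) (s⁻¹ u) (l u) (l v))
          (0≤x+y (proj₁ (∣∣≤-* (∣s⁻¹∣≤r u) d)) (l-tangent u v)) ,
        ≤-respʳ-≈ (solve 7 (λ r e x y r′ l m →
            (r :* e :+ r′ :* (y :- x)) :+ ((x :- y) :* r′ :- (l :- m)) := r :* e :+ (m :- l))
            refl r e (ι u) (ι v) (s⁻¹ v) (l u) (l v))
          (0≤x+y (proj₂ (∣∣≤-* (∣s⁻¹∣≤r v) d)) (l-tangent v u))

      -- The tangent at `u` makes the error at most zero; the tangent at `v` makes it at least minus
      -- the squared increment times both reciprocals.
      quad : ∀ u v {e} → ∣ ι v - ι u ∣≤ e → ∣ l v - l u - s⁻¹ u * (ι v - ι u) ∣≤ r * r * (e * e)
      quad u v {e} d =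
        ≤-respʳ-≈ (solve 6 (λ r e x r′ l m →
            (r :* r) :* (e :* e) :+ (x :* r′ :- (m :- l)) := r :* r :* (e :* e) :- (m :- l :- r′ :* x))
            refl r e (ι v - ι u) (s⁻¹ u) (l u) (l v))
          (0≤x+y (0≤x*y (0≤x*x r) (0≤x*x e)) (l-tangent u v)) ,
        ≤-respʳ-≈ (begin
          r * r * (e * e) - s⁻¹ u * s⁻¹ v * ((y - x) * (y - x)) + ((x - y) * s⁻¹ v - (l u - l v))
            ≈⟨ solve 8 (λ r e x y p q l m →
              r :* r :* (e :* e) :- p :* q :* ((y :- x) :* (y :- x)) :+ ((x :- y) :* q :- (l :- m))
              := r :* r :* (e :* e) :- (y :- x) :* ((y :- x) :* (p :* q)) :+ ((x :- y) :* q :- (l :- m)))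
              refl r e x y (s⁻¹ u) (s⁻¹ v) (l u) (l v) ⟩
          r * r * (e * e) - (y - x) * ((y - x) * (s⁻¹ u * s⁻¹ v)) + ((x - y) * s⁻¹ v - (l u - l v))
            ≈⟨ +-congʳ (+-congˡ (-‿cong (*-congˡ s⁻¹-difference))) ⟨
          r * r * (e * e) - (y - x) * (s⁻¹ u - s⁻¹ v) + ((x - y) * s⁻¹ v - (l u - l v))
            ≈⟨ solve 8 (λ r e x y p q l m →
              r :* r :* (e :* e) :- (y :- x) :* (p :- q) :+ ((x :- y) :* q :- (l :- m))
              := r :* r :* (e :* e) :+ (m :- l :- p :* (y :- x)))
              refl r e x y (s⁻¹ u) (s⁻¹ v) (l u) (l v) ⟩
          r * r * (e * e) + (l v - l u - s⁻¹ u * (y - x)) ∎)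
          (0≤x+y (proj₁ (∣∣≤-* (∣∣≤-* (∣s⁻¹∣≤r u) (∣s⁻¹∣≤r v)) (∣∣≤-* d d))) (l-tangent v u))
        where
        open ≈-Reasoning setoid
        x = ι u
        y = ι v
        s⁻¹-difference : s⁻¹ u - s⁻¹ v ≈ (y - x) * (s⁻¹ u * s⁻¹ v)
        s⁻¹-difference = trans (reciprocal-difference (x + a) (pos u) (y + a) (pos v))
          (*-congʳ (solve 3 (λ a x y → y :+ a :- (x :+ a) := y :- x) refl a x y))

-- Iterated integrals of the shifted logarithm

module ShiftedLogarithm {c ℓ₁ ℓ₂} (ℝ : RealField c ℓ₁ ℓ₂)
  (ln : Analysis.PartialFunction ℝ (Analysis.Positive ℝ)) (isLn : Analysis.IsLn ℝ ln)
  (a : RealField.Carrier ℝ) (0<a : Analysis.Positive ℝ a) where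
  open RealField ℝ hiding (zero)
  open Analysis ℝ
  open OrderedField ℝ
  open Differentiation ℝ
  open FundamentalTheorem ℝ
  open Chains ℝ using (integral-cong; integral-unique)
  open Logarithm ℝ
  open IntegerRingSolver commutativeRing
  open SemiringMult semiring using (×1-homo-*; ×-homo-1)
  open SemiringSum semiring using (*-distribˡ-sum; sum-init-last; sum-cong-≋; sum-cong-≗)

  Domain : Carrier → Set ℓ₂
  Domain x = 0# < x + a

  -- n! times the n-th iterated integral, by the recursion which the closed form satisfies.
  Q : ℕ → PartialFunction Domain
  Q zero    x 0<x+a = ln (x + a) 0<x+a
  Q (suc n) x 0<x+a =
    (x + a) * Q n x 0<x+a + (- 1/ suc n) * x ^ suc n + (- (a * ln a 0<a)) * x ^ n

  1/-inverseˡ : ∀ n .{{_ : NonZero n}} → 1/ n * (n · 1#) ≈ 1#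
  1/-inverseˡ n = trans (*-comm _ _) (*-inverseʳ (n · 1#) (#0 (0<n n)))

  -1/n*n≈-1 : ∀ n .{{_ : NonZero n}} → (- 1/ n) * (n · 1#) ≈ - 1#
  -1/n*n≈-1 n = trans (solve 2 (λ x y → :- x :* y := :- (x :* y)) refl (1/ n) (n · 1#))
    (-‿cong (1/-inverseˡ n))

  0∈Domain : Domain 0#
  0∈Domain = <-≤-trans 0<a (≤-reflexive (sym (+-identityˡ a)))

  -- At the first stage a ln(0 + a) cancels against the term with `a * ln a`; afterwards every
  -- summand contains a vanishing factor.
  Q-at-0 : ∀ n 0<0+a → Q (suc n) 0# 0<0+a ≈ 0#
  Q-at-0 zero 0<0+a = trans (+-congʳ (+-congʳ (*-congˡ (ln-cong ln isLn 0<0+a 0<a (+-identityˡ a)))))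
    (solve 3 (λ a l i → (:0 :+ a) :* l :+ :- i :* (:0 :* :1) :+ :- (a :* l) :* :1 := :0) refl a (ln a 0<a) (1/ 1))
  Q-at-0 (suc n) 0<0+a = trans (+-congʳ (+-congʳ (*-congˡ (Q-at-0 n 0<0+a))))
    (solve 5 (λ a c i p q → (:0 :+ a) :* :0 :+ :- i :* (:0 :* p) :+ c :* (:0 :* q) := :0)
      refl a (- (a * ln a 0<a)) (1/ suc (suc n)) (0# ^ suc n) (0# ^ n))

  module _ (x : Carrier) (0<x+a : Domain x) where

    private
      ι : Segment Domain 0# x → Carrier
      ι = proj₁

      pos : ∀ u → 0# < ι u + a
      pos u = proj₁ (proj₂ u)

      -- Since 1/(t + a) decreases, it is at most 1/a when 0 ≤ t and at most 1/(x + a) when x ≤ t;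
      -- the sum `r` covers both directions. `w` dominates both x and -x.
      w r : Carrier
      w = 1# + x * x
      r = reciprocal a 0<a + reciprocal (x + a) 0<x+a

      between-bound : ∀ {t} → Between 0# x t → ∣ t ∣≤ w
      between-bound {t} (inj₁ (0≤t , t≤x)) =
        ≤-respʳ-≈ (solve 3 (λ w x t → (w :- x) :+ (x :- t) := w :- t) refl w x t)
          (0≤x+y (proj₁ (∣x∣≤1+x² x)) (x≤y⇒0≤y-x t≤x)) ,
        0≤x+y (∣∣≤⇒0≤ (∣x∣≤1+x² x)) 0≤t
      between-bound {t} (inj₂ (x≤t , t≤0)) =
        ≤-respʳ-≈ (solve 2 (λ w t → w :+ (:0 :- t) := w :- t) refl w t)
          (0≤x+y (∣∣≤⇒0≤ (∣x∣≤1+x² x)) (x≤y⇒0≤y-x t≤0)) ,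
        ≤-respʳ-≈ (solve 3 (λ w x t → (w :+ x) :+ (t :- x) := w :+ t) refl w x t)
          (0≤x+y (proj₂ (∣x∣≤1+x² x)) (x≤y⇒0≤y-x x≤t))

      ∣ι∣≤w : ∀ u → ∣ ι u ∣≤ w
      ∣ι∣≤w (t , _ , ¬¬btw) =
        (λ w-t<0 → ¬¬btw λ btw → proj₁ (between-bound btw) w-t<0) ,
        (λ w+t<0 → ¬¬btw λ btw → proj₂ (between-bound btw) w+t<0)

      antitone : ∀ u v 0<u 0<v → u ≤ v → 0# ≤ reciprocal u 0<u - reciprocal v 0<v
      antitone u v 0<u 0<v u≤v = ≤-respʳ-≈ (sym (reciprocal-difference u 0<u v 0<v))
        (0≤x*y (x≤y⇒0≤y-x u≤v) (<⇒≤ (*-pos (0<reciprocal u 0<u) (0<reciprocal v 0<v))))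

      reciprocal≤r : ∀ {t} 0<t+a → Between 0# x t → 0# ≤ r - reciprocal (t + a) 0<t+a
      reciprocal≤r {t} 0<t+a (inj₁ (0≤t , _)) =
        ≤-respʳ-≈ (solve 3 (λ p q s → (p :- s) :+ q := p :+ q :- s) refl
            (reciprocal a 0<a) (reciprocal (x + a) 0<x+a) (reciprocal (t + a) 0<t+a))
          (0≤x+y (antitone a (t + a) 0<a 0<t+a (0≤⇒≤ 0≤t (solve 2 (λ a t → t := t :+ a :- a) refl a t)))
            (<⇒≤ (0<reciprocal (x + a) 0<x+a)))
      reciprocal≤r {t} 0<t+a (inj₂ (x≤t , _)) =
        ≤-respʳ-≈ (solve 3 (λ p q s → (q :- s) :+ p := p :+ q :- s) refl
            (reciprocal a 0<a) (reciprocal (x + a) 0<x+a) (reciprocal (t + a) 0<t+a))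
          (0≤x+y (antitone (x + a) (t + a) 0<x+a 0<t+a
              (0≤⇒≤ (x≤y⇒0≤y-x x≤t) (solve 3 (λ a x t → t :- x := t :+ a :- (x :+ a)) refl a x t)))
            (<⇒≤ (0<reciprocal a 0<a)))

      ∣reciprocal∣≤r : ∀ u → ∣ reciprocal (ι u + a) (pos u) ∣≤ r
      ∣reciprocal∣≤r (t , 0<t+a , ¬¬btw) =
        (λ r-s<0 → ¬¬btw λ btw → reciprocal≤r 0<t+a btw r-s<0) ,
        0≤x+y (0≤x+y (<⇒≤ (0<reciprocal a 0<a)) (<⇒≤ (0<reciprocal (x + a) 0<x+a)))
          (<⇒≤ (0<reciprocal (t + a) 0<t+a))

      origin : Segment Domain 0# x
      origin = segment-start Domain 0# x 0∈Domain

      shift : HasDerivative ι (λ u → ι u + a) (λ _ → 1# + 0#)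
      shift = _+′_ ι (identity ι ∣ι∣≤w) (const ι a)

      ln-shift : HasDerivative ι (λ u → ln (ι u + a) (pos u)) (λ u → reciprocal (ι u + a) (pos u))
      ln-shift = ln-hasDerivative ln isLn ι a pos ∣reciprocal∣≤r origin
        (λ u → ∣∣≤-cong (solve 1 (λ t → t := t :- :0) refl (ι u)) (∣ι∣≤w u))

    Q-hasDerivative : ∀ n → HasDerivative ι (λ u → Q (suc n) (ι u) (pos u))
      (λ u → (suc n · 1#) * Q n (ι u) (pos u))
    Q-hasDerivative zero = resp-≈ ι (λ _ → refl) derivative
      (_+′_ ι (_+′_ ι (_*′_ ι shift ln-shift) (_*ₗ_ ι (- 1/ 1) (power ι ∣ι∣≤w 0)))
              (_*ₗ_ ι (- (a * ln a 0<a)) (const ι 1#)))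
      where
      derivative : ∀ u → (1# + 0#) * ln (ι u + a) (pos u) + (ι u + a) * reciprocal (ι u + a) (pos u)
          + (- 1/ 1) * ((1 · 1#) * 1#) + (- (a * ln a 0<a)) * 0#
        ≈ (1 · 1#) * ln (ι u + a) (pos u)
      -- The product s · (1/s) from the product rule equals 1 and cancels the derivative of -x.
      derivative u = trans (+-congʳ (+-cong (+-congˡ (*-reciprocal (ι u + a) (pos u)))
          (trans (*-congˡ (*-identityʳ (1 · 1#))) (-1/n*n≈-1 1))))
        (solve 2 (λ l c → (:1 :+ :0) :* l :+ :1 :+ :- :1 :+ c :* :0 := (:1 :+ :0) :* l)
          refl (ln (ι u + a) (pos u)) (- (a * ln a 0<a)))
    Q-hasDerivative (suc n) = resp-≈ ι (λ _ → refl) derivative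
      (_+′_ ι (_+′_ ι (_*′_ ι shift (Q-hasDerivative n)) (_*ₗ_ ι (- 1/ suc (suc n)) (power ι ∣ι∣≤w (suc n))))
              (_*ₗ_ ι (- (a * ln a 0<a)) (power ι ∣ι∣≤w n)))
      where
      N = suc n · 1#
      k = - (a * ln a 0<a)
      derivative : ∀ u → (1# + 0#) * Q (suc n) (ι u) (pos u) + (ι u + a) * (N * Q n (ι u) (pos u))
          + (- 1/ suc (suc n)) * ((suc (suc n) · 1#) * ι u ^ suc n) + k * (N * ι u ^ n)
        ≈ (suc (suc n) · 1#) * Q (suc n) (ι u) (pos u)
      derivative u = begin
        (1# + 0#) * q′ + (ι u + a) * (N * q) + (- 1/ suc (suc n)) * (N′ * p′) + k * (N * p)
          ≈⟨ +-congʳ (+-congˡ (trans (sym (*-assoc _ N′ p′)) (*-congʳ (-1/n*n≈-1 (suc (suc n)))))) ⟩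
        (1# + 0#) * q′ + (ι u + a) * (N * q) + (- 1#) * p′ + k * (N * p)
          -- The coefficient -1 is expanded again, now as -(1/(n + 1)) · (n + 1), so that `N`
          -- factors out of the defining recursion of `q′`.
          ≈⟨ +-congʳ (+-congˡ (*-congʳ (-1/n*n≈-1 (suc n)))) ⟨
        (1# + 0#) * q′ + (ι u + a) * (N * q) + (- 1/ suc n) * N * p′ + k * (N * p)
          ≈⟨ solve 8 (λ q′ s N q i p′ k p →
            (:1 :+ :0) :* q′ :+ s :* (N :* q) :+ :- i :* N :* p′ :+ k :* (N :* p)
            := q′ :+ N :* (s :* q :+ :- i :* p′ :+ k :* p)) refl q′ (ι u + a) N q (1/ suc n) p′ k p ⟩
        q′ + N * q′
          ≈⟨ solve 2 (λ q′ N → q′ :+ N :* q′ := (:1 :+ N) :* q′) refl q′ N ⟩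
        N′ * q′ ∎
        where
        open ≈-Reasoning setoid
        N′ = suc (suc n) · 1#
        q  = Q n (ι u) (pos u)
        q′ = Q (suc n) (ι u) (pos u)
        p  = ι u ^ n
        p′ = ι u ^ suc n

  infix 9 1/!_
  1/!_ : ℕ → Carrier
  1/! n = (1/ (n !)) {{n !≢0}}

  1/!-suc : ∀ n → 1/! suc n * (suc n · 1#) ≈ 1/! n
  1/!-suc n = begin
    i * N                 ≈⟨ *-identityʳ (i * N) ⟨
    i * N * 1#            ≈⟨ *-congˡ (1/-inverseˡ (n !) {{n !≢0}}) ⟨
    i * N * (j * B)       ≈⟨ solve 4 (λ i N j B → i :* N :* (j :* B) := i :* (N :* B) :* j) refl i N j B ⟩
    i * (N * B) * j       ≈⟨ *-congʳ (*-congˡ (×1-homo-* (suc n) (n !))) ⟨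
    i * (((suc n) !) · 1#) * j ≈⟨ *-congʳ (1/-inverseˡ ((suc n) !) {{suc n !≢0}}) ⟩
    1# * j                ≈⟨ *-identityˡ j ⟩
    j                     ∎
    where
    open ≈-Reasoning setoid
    i = 1/! suc n
    j = 1/! n
    N = suc n · 1#
    B = (n !) · 1#

  F : ℕ → PartialFunction Domain
  F n x 0<x+a = 1/! n * Q n x 0<x+a

  F-0 : ∀ x 0<x+a → F 0 x 0<x+a ≈ ln (x + a) 0<x+a
  F-0 x 0<x+a = trans (*-congʳ (trans (sym (*-identityʳ (1/! 0)))
    (trans (*-congˡ (sym (×-homo-1 1#))) (1/-inverseˡ (0 !) {{0 !≢0}})))) (*-identityˡ _)

  -- Stated for any `f` agreeing with `F n`, because a given sequence of iterated integrals is known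
  -- only up to `≈`; both implications use it.
  F-integral : ∀ n (f : PartialFunction Domain) → (∀ t 0<t+a → f t 0<t+a ≈ F n t 0<t+a) →
    ∀ x 0<x+a → IsIntegral f 0# x (F (suc n) x 0<x+a)
  F-integral n f f≈F x 0<x+a = integral-cong f
    (trans (+-congˡ (-‿cong (*-congˡ (Q-at-0 n 0∈Domain))))
      (solve 2 (λ y i → y :- i :* :0 := y) refl (F (suc n) x 0<x+a) (1/! suc n)))
    (fundamental-theorem segment⊆Domain 0∈Domain 0<x+a
      (∣∣≤-cong (solve 1 (λ x → x := x :- :0) refl x) (∣x∣≤1+x² x))
      (_*ₗ_ proj₁ (1/! suc n) (Q-hasDerivative x 0<x+a n)) f
      λ t 0<t+a _ → trans (f≈F t 0<t+a)
        (trans (*-congʳ (sym (1/!-suc n))) (*-assoc (1/! suc n) (suc n · 1#) (Q n t 0<t+a))))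
    where
    segment⊆Domain : ∀ t → Between 0# x t → Domain t
    segment⊆Domain t (inj₁ (0≤t , _)) =
      <-≤-trans 0<a (0≤⇒≤ 0≤t (solve 2 (λ a t → t := t :+ a :- a) refl a t))
    segment⊆Domain t (inj₂ (x≤t , _)) =
      <-≤-trans 0<x+a (0≤⇒≤ (x≤y⇒0≤y-x x≤t) (solve 3 (λ a x t → t :- x := t :+ a :- (x :+ a)) refl a x t))

  -- The recursion solved in closed form

  P : ℕ → Carrier → Carrier
  P n x = ∑₁ n (λ k → x ^ k * (x + a) ^ (n ∸ k) * 1/ k)

  sum-last : ∀ n (h : ℕ → Carrier) → sum {suc n} (λ i → h (toℕ i)) ≈ sum {n} (λ i → h (toℕ i)) + h n
  sum-last n h = trans (sum-init-last (λ i → h (toℕ i)))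
    (+-cong (reflexive (sum-cong-≗ {n} (λ i → ≡.cong h (toℕ-inject₁ i))))
      (reflexive (≡.cong h (toℕ-fromℕ n))))

  -- The last term carries the zeroth power of x + a; in every other term the exponent of x + a has
  -- grown by one.
  P-suc : ∀ n x → P (suc n) x ≈ (x + a) * P n x + x ^ suc n * 1/ suc n
  P-suc n x = trans (sum-last n (λ k → x ^ suc k * s ^ (n ∸ k) * 1/ suc k))
    (+-cong (trans (sum-cong-≋ {n} term) (sym (*-distribˡ-sum {n} s (λ i → summand (toℕ i)))))
      (*-congʳ (trans (*-congˡ (reflexive (≡.cong (s ^_) (ℕ.n∸n≡0 n)))) (*-identityʳ _))))
    where
    s = x + a
    summand : ℕ → Carrier
    summand k = x ^ suc k * s ^ (n ∸ suc k) * 1/ suc k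
    term : ∀ (i : Fin n) → x ^ suc (toℕ i) * s ^ (n ∸ toℕ i) * 1/ suc (toℕ i) ≈ s * summand (toℕ i)
    -- The bound `toℕ<n i` guarantees that the subtraction in the exponent is not truncated.
    term i = trans (*-congʳ (*-congˡ (reflexive (≡.cong (s ^_) (ℕ.+-∸-assoc 1 (toℕ<n i))))))
      (solve 4 (λ p s q i → p :* (s :* q) :* i := s :* (p :* q :* i)) refl
        (x ^ suc (toℕ i)) s (s ^ (n ∸ suc (toℕ i))) (1/ suc (toℕ i)))

  -- The term - a xⁿ ln a of the recursion arises from sⁿ⁺¹ - xⁿ⁺¹ = s (sⁿ - xⁿ) + a xⁿ.
  Q-closed : ∀ n x 0<x+a → Q n x 0<x+a ≈
    - P n x - ((x + a) ^ n - x ^ n) * ln a 0<a + (x + a) ^ n * ln (x + a) 0<x+a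
  Q-closed zero x 0<x+a =
    solve 2 (λ l m → m := :- :0 :- (:1 :- :1) :* l :+ :1 :* m) refl (ln a 0<a) (ln (x + a) 0<x+a)
  Q-closed (suc n) x 0<x+a = begin
    (x + a) * Q n x 0<x+a + (- i) * (x * xⁿ) + (- (a * l)) * xⁿ
      ≈⟨ +-congʳ (+-congʳ (*-congˡ (Q-closed n x 0<x+a))) ⟩
    (x + a) * (- P n x - (sⁿ - xⁿ) * l + sⁿ * m) + (- i) * (x * xⁿ) + (- (a * l)) * xⁿ
      ≈⟨ solve 8 (λ x a p s y l m i →
        (x :+ a) :* (:- p :- (s :- y) :* l :+ s :* m) :+ :- i :* (x :* y) :+ :- (a :* l) :* y
        := :- ((x :+ a) :* p :+ x :* y :* i) :- ((x :+ a) :* s :- x :* y) :* l :+ (x :+ a) :* s :* m)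
        refl x a (P n x) sⁿ xⁿ l m i ⟩
    - ((x + a) * P n x + x * xⁿ * i) - ((x + a) * sⁿ - x * xⁿ) * l + (x + a) * sⁿ * m
      ≈⟨ +-congʳ (+-congʳ (-‿cong (P-suc n x))) ⟨
    - P (suc n) x - ((x + a) * sⁿ - x * xⁿ) * l + (x + a) * sⁿ * m ∎
    where
    open ≈-Reasoning setoid
    i  = 1/ suc n
    l  = ln a 0<a
    m  = ln (x + a) 0<x+a
    sⁿ = (x + a) ^ n
    xⁿ = x ^ n

  F-closed : ∀ n x 0<x+a → F n x 0<x+a ≈
    - 1/! n * P n x - ((x + a) ^ n - x ^ n) * 1/! n * ln a 0<a + (x + a) ^ n * 1/! n * ln (x + a) 0<x+a
  F-closed n x 0<x+a = trans (*-congˡ (Q-closed n x 0<x+a))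
    (solve 6 (λ j p s y l m → j :* (:- p :- (s :- y) :* l :+ s :* m)
        := :- j :* p :- (s :- y) :* j :* l :+ s :* j :* m)
      refl (1/! n) (P n x) ((x + a) ^ n) (x ^ n) (ln a 0<a) (ln (x + a) 0<x+a))

  -- Once `f n` agrees with `F n`, both `f (suc n)` and `F (suc n)` are integrals of `f n`, and
  -- uniqueness of the integral equates them.
  iteratedIntegrals⇒F : ∀ {f} → IsIteratedIntegrals (λ x 0<x+a → ln (x + a) 0<x+a) f →
    ∀ n x 0<x+a → f n x 0<x+a ≈ F n x 0<x+a
  iteratedIntegrals⇒F iterated zero x 0<x+a =
    trans (IsIteratedIntegrals.base iterated x 0<x+a) (sym (F-0 x 0<x+a))
  iteratedIntegrals⇒F {f} iterated (suc n) x 0<x+a = integral-unique (f n)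
    (IsIteratedIntegrals.step iterated n x 0<x+a)
    (F-integral n (f n) (iteratedIntegrals⇒F iterated n) x 0<x+a)

  F⇒iteratedIntegrals : ∀ {f} → (∀ n x 0<x+a → f n x 0<x+a ≈ F n x 0<x+a) →
    IsIteratedIntegrals (λ x 0<x+a → ln (x + a) 0<x+a) f
  F⇒iteratedIntegrals {f} f≈F = record
    { base = λ x 0<x+a → trans (f≈F 0 x 0<x+a) (F-0 x 0<x+a)
    ; step = λ n x 0<x+a → integral-cong (f n) (sym (f≈F (suc n) x 0<x+a)) (F-integral n (f n) (f≈F n) x 0<x+a)
    }

theorem3p1 : ∀ {c ℓ₁ ℓ₂} (ℝ : RealField c ℓ₁ ℓ₂) →
    let open RealField ℝ
        open Analysis ℝ in
    (ln : PartialFunction Positive) → IsLn ln →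
    (a : Carrier) (0<a : 0# < a) →
    (f : ℕ → PartialFunction (λ x → 0# < x + a)) →
    IsIteratedIntegrals (λ x 0<x+a → ln (x + a) 0<x+a) f
    ⇔
    (∀ n x (0<x+a : 0# < x + a) →
      let 1/n! = (1/ (n !)) {{n !≢0}} in
      f n x 0<x+a ≈
        - 1/n! * ∑₁ n (λ k → x ^ k * (x + a) ^ (n ∸ k) * 1/ k)
        - ((x + a) ^ n - x ^ n) * 1/n! * ln a 0<a
        + (x + a) ^ n * 1/n! * ln (x + a) 0<x+a)
theorem3p1 ℝ ln isLn a 0<a f = mk⇔
  (λ iterated n x 0<x+a → trans (iteratedIntegrals⇒F iterated n x 0<x+a) (F-closed n x 0<x+a))
  (λ closed → F⇒iteratedIntegrals λ n x 0<x+a → trans (closed n x 0<x+a) (sym (F-closed n x 0<x+a)))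
  where
  open RealField ℝ
  open ShiftedLogarithm ℝ ln isLn a 0<a
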